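{- Let $k\ge 1$ and $n\ge 2k-1$ be integers, and let $\mathcal{F}\subseteq 2^{[n]}$ be $[k]$-differencing. Then $|\mathcal{F}|\le\binom{n}{k}$. Moreover, equality holds if and only if $\mathcal{F}=\binom{[n]}{k}$ or $\mathcal{F}=\binom{[n]}{n-k}$.
   Context: For a positive integer $m$, $[m]=\{1,\ldots,m\}$, and $\binom{[m]}{j}$ denotes the family of all $j$-element subsets of $[m]$. A family $\mathcal{F}\subseteq 2^{[n]}$ of subsets of $[n]$ is called $[k]$-differencing if $|A\setminus B|\in\{1,\ldots,k\}$ for every ordered pair of distinct members $A,B\in\mathcal{F}$. -}

module Defs where

open import Data.Nat.Base using (ℕ; _≤_)
open import Data.Fin.Subset using (Subset; ∣_∣; _─_)
open import Data.List.Base using (List; length)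
open import Data.List.Membership.Propositional using (_∈_)
open import Data.List.Relation.Unary.Unique.Propositional using (Unique)
open import Data.Product.Base using (_×_)
open import Level using (0ℓ)
open import Relation.Binary.PropositionalEquality.Core using (_≡_; _≢_)
open import Relation.Unary using (Pred; _≐_)

-- A family 𝓕 ⊆ 2^[n], enumerated without repetition, so that the length of
-- the enumeration is the cardinality. The ground set [n] is Fin n.
-- The order of the enumeration carries no meaning: families are compared only
-- through their members (see _≗_).

record Family (n : ℕ) : Set where
  constructor family
  field
    members : List (Subset n)
    unique  : Unique members

open Family public

infix 4 _∈ᶠ_ _≗_

_∈ᶠ_ : ∀ {n} → Subset n → Family n → Set
A ∈ᶠ 𝓕 = A ∈ members 𝓕

card : ∀ {n} → Family n → ℕ
card 𝓕 = length (members 𝓕)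

-- Quantifying over all (A , B) covers both orders of each pair, so 1 ≤ ∣ A ─ B ∣
-- makes a differencing family an antichain.

Differencing : ∀ {n} → ℕ → Family n → Set
Differencing k 𝓕 = ∀ A B → A ∈ᶠ 𝓕 → B ∈ᶠ 𝓕 → A ≢ B →
                   1 ≤ ∣ A ─ B ∣ × ∣ A ─ B ∣ ≤ k

Layer : ∀ n → ℕ → Pred (Subset n) 0ℓ
Layer n j A = ∣ A ∣ ≡ j

_≗_ : ∀ {n} → Family n → Pred (Subset n) 0ℓ → Set
𝓕 ≗ P = (_∈ᶠ 𝓕) ≐ P

{-# OPTIONS --safe #-}

-- Let V be the space of functions on the k-subsets T of [n], so dim V = n C k.
-- A set A with ∣ A ∣ ≥ k gives the vector v_A(T) = [T ⊆ A] and the functional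
-- f_A(T) = (-1)ⁱ (k - i)! p (p + 1) ⋯ (p + i - 1), i = ∣ T ─ A ∣, p = ∣ A ∣ - k.
-- With m = ∣ A ∩ B ∣, e = ∣ A ─ B ∣, d = ∣ B ─ A ∣ ≤ k one computes
--   ⟨f_A , v_B⟩ = (1 - e)(2 - e) ⋯ (d - e) · m (m - 1) ⋯ (m - (k - d) + 1),
-- which vanishes if 1 ≤ e ≤ d and not if A = B or e = d + 1 (and ∣ A ∣ > k).
-- A set with ∣ A ∣ < k uses f_A(T) = [A ⊆ T] and the vector that the same
-- construction gives after complementing everything. Along a differencing family
-- ordered by size these pairs are triangular, hence ∣ 𝓕 ∣ ≤ n C k.
--
-- In the equality case no further pair can be added. If 𝓕 is not uniform, take A₀
-- of minimum size l, a larger B, X = A₀ ∪ {x} and Y ⊆ B with ∣ Y ∣ = l: the pair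
-- (f_X , v_Y) can be inserted after level l. If 𝓕 lies in a level l > k, l ≠ n - k,
-- fix a k-set T: evaluation at T can be inserted, together with a combination of v_T
-- and the v_{T ∪ x}, x ∉ T, between the members that contain T and those that do not.
-- A level l < k with l ≠ n - k is too small.
module Submission where

open import Defs
open import Data.Bool.Properties using () renaming (_≟_ to _≟ᵇ_)
open import Data.Fin.Subset using (Subset; inside; outside; ∣_∣; _─_; _∩_; ∁; ⊤)
open import Data.Fin.Subset.Properties using (∣⊤∣≡n; ∣∁p∣≡n∸∣p∣; ∣p∣≤n; ∣p─q∣≤∣p∣)
open import Data.Integer.Base as ℤ using (ℤ; +_; 0ℤ; 1ℤ)
import Data.Integer.Properties as ℤ
open import Data.Integer.Tactic.RingSolver using (solve-∀)
open import Data.List.Base using (List; []; _∷_; length; map; _++_)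
open import Data.List.Membership.DecPropositional using () renaming (_∈?_ to ∈-dec)
open import Data.List.Membership.Propositional using (_∈_)
open import Data.List.Membership.Propositional.Properties using (∈-map⁺; ∈-map⁻; ∈-++⁺ˡ; ∈-++⁺ʳ; ∈-++⁻; ∈-∃++)
open import Data.List.Properties using (length-map; length-++)
open import Data.List.Relation.Binary.Permutation.Propositional using (↭-sym; ↭⇒↭ₛ)
open import Data.List.Relation.Binary.Permutation.Propositional.Properties using (↭-length; All-resp-↭)
import Data.List.Relation.Binary.Permutation.Setoid.Properties as Permutationₛ
open import Data.List.Relation.Unary.All as All using (All; []; _∷_)
import Data.List.Relation.Unary.All.Properties as All
open import Data.List.Relation.Unary.AllPairs as AllPairs using (AllPairs; []; _∷_)
import Data.List.Relation.Unary.AllPairs.Properties as AllPairs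
open import Data.List.Relation.Unary.Any using (here; there)
open import Data.List.Relation.Unary.Linked.Properties using (Linked⇒AllPairs)
open import Data.List.Relation.Unary.Unique.Propositional using (Unique)
import Data.List.Relation.Unary.Unique.Propositional.Properties as Unique
import Data.List.Sort as Sort
open import Data.Nat.Base as ℕ using (ℕ; zero; suc; _≤_; _<_; _*_; _∸_; z≤n; s≤s; _!)
open import Data.Nat.Combinatorics using (_C_; nCk+nC[k+1]≡[n+1]C[k+1]; nCn≡1; k>n⇒nCk≡0; nCk≡nC[n∸k]; nC1≡n)
import Data.Nat.Properties as ℕ
open import Data.Product.Base using (_×_; _,_; proj₁; proj₂; ∃-syntax)
open import Data.Sum.Base using (_⊎_; inj₁; inj₂; [_,_]′)
open import Data.Vec.Base using ([]; _∷_)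
open import Data.Vec.Properties using (≡-dec; ∷-injectiveʳ)
open import Function.Base using (_∘_)
open import Function.Bundles using (_⇔_; mk⇔)
import Relation.Binary.Construct.On as On
open import Relation.Binary.Definitions using (tri<; tri≈; tri>)
open import Relation.Binary.PropositionalEquality hiding (_≗_; [_])
open import Relation.Nullary using (¬_; Dec; yes; no; contradiction)

-- Triangular systems of functionals and vectors

*-≢0 : ∀ {i j} → i ≢ 0ℤ → j ≢ 0ℤ → i ℤ.* j ≢ 0ℤ
*-≢0 {i} i≢0 j≢0 ij≡0 = [ i≢0 , j≢0 ]′ (ℤ.i*j≡0⇒i≡0∨j≡0 i ij≡0)

∑ : ∀ {a} {I : Set a} → List I → (I → ℤ) → ℤ
∑ []       f = 0ℤ
∑ (x ∷ xs) f = f x ℤ.+ ∑ xs f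

module _ {a} {I : Set a} where

  ∑-cong : ∀ (xs : List I) {f g} → (∀ x → f x ≡ g x) → ∑ xs f ≡ ∑ xs g
  ∑-cong []       eq = refl
  ∑-cong (x ∷ xs) eq = cong₂ ℤ._+_ (eq x) (∑-cong xs eq)

  ∑-zero : ∀ (xs : List I) {f} → (∀ x → f x ≡ 0ℤ) → ∑ xs f ≡ 0ℤ
  ∑-zero []       eq = refl
  ∑-zero (x ∷ xs) eq = cong₂ ℤ._+_ (eq x) (∑-zero xs eq)

  ∑-++ : ∀ (xs ys : List I) f → ∑ (xs ++ ys) f ≡ ∑ xs f ℤ.+ ∑ ys f
  ∑-++ []       ys f = sym (ℤ.+-identityˡ _)
  ∑-++ (x ∷ xs) ys f = trans (cong (ℤ._+_ (f x)) (∑-++ xs ys f)) (sym (ℤ.+-assoc (f x) _ _))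

  ∑-map : ∀ {b} {J : Set b} (h : J → I) ys f → ∑ (map h ys) f ≡ ∑ ys (f ∘ h)
  ∑-map h []       f = refl
  ∑-map h (y ∷ ys) f = cong (ℤ._+_ (f (h y))) (∑-map h ys f)

  ⟨_∣_∣_⟩ : (I → ℤ) → List I → (I → ℤ) → ℤ
  ⟨ f ∣ xs ∣ v ⟩ = ∑ xs λ x → f x ℤ.* v x

  ⟨⟩-linear : ∀ f (xs : List I) s u t v →
    ⟨ f ∣ xs ∣ (λ x → s ℤ.* u x ℤ.+ t ℤ.* v x) ⟩ ≡ s ℤ.* ⟨ f ∣ xs ∣ u ⟩ ℤ.+ t ℤ.* ⟨ f ∣ xs ∣ v ⟩
  ⟨⟩-linear f []       s u t v = lemma s t
    where
    lemma : ∀ s t → 0ℤ ≡ s ℤ.* 0ℤ ℤ.+ t ℤ.* 0ℤ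
    lemma = solve-∀
  ⟨⟩-linear f (x ∷ xs) s u t v =
    trans (cong (ℤ._+_ (f x ℤ.* (s ℤ.* u x ℤ.+ t ℤ.* v x))) (⟨⟩-linear f xs s u t v)) (lemma (f x) s (u x) t (v x) _ _)
    where
    lemma : ∀ f s u t v a b → f ℤ.* (s ℤ.* u ℤ.+ t ℤ.* v) ℤ.+ (s ℤ.* a ℤ.+ t ℤ.* b)
          ≡ s ℤ.* (f ℤ.* u ℤ.+ a) ℤ.+ t ℤ.* (f ℤ.* v ℤ.+ b)
    lemma = solve-∀

  record Test : Set a where
    constructor test
    field
      key        : ℕ
      functional : I → ℤ
      vector     : I → ℤ

  open Test public

  Annihilates : List I → Test → Test → Set
  Annihilates xs p q = ⟨ functional p ∣ xs ∣ vector q ⟩ ≡ 0ℤ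

  Detects : List I → Test → Set
  Detects xs p = ⟨ functional p ∣ xs ∣ vector p ⟩ ≢ 0ℤ

  Triangular : List I → List Test → Set a
  Triangular xs ps = AllPairs (Annihilates xs) ps × All (Detects xs) ps

  VanishingAt : I → Test → Set
  VanishingAt x p = vector p x ≡ 0ℤ

  -- One step of column elimination. The pivot is taken as late as possible:
  -- adding multiples of a later vector to an earlier one keeps the tests
  -- triangular, because functionals only have to annihilate later vectors.
  record Reduction (x : I) (xs : List I) (ps : List Test) : Set a where
    field
      reduced    : List Test
      pivot      : I → ℤ
      pivot≢0    : pivot x ≢ 0ℤ
      preserves  : ∀ f → All (λ p → ⟨ f ∣ x ∷ xs ∣ vector p ⟩ ≡ 0ℤ) ps →
                   ⟨ f ∣ x ∷ xs ∣ pivot ⟩ ≡ 0ℤ × All (λ q → ⟨ f ∣ x ∷ xs ∣ vector q ⟩ ≡ 0ℤ) reduced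
      triangular : Triangular (x ∷ xs) reduced
      vanishing  : All (VanishingAt x) reduced
      length-red : length ps ≡ suc (length reduced)

  -- Works from the right. With no pivot among the later tests, `p` itself becomes the pivot if its
  -- vector is nonzero at `x`. Otherwise a multiple of the pivot clears the entry of `p`; the
  -- functional of `p` annihilates every later vector, hence the pivot, so its value on the new
  -- vector is only rescaled.
  reduce : ∀ x xs ps → Triangular (x ∷ xs) ps → All (VanishingAt x) ps ⊎ Reduction x xs ps
  reduce x xs []       _ = inj₁ []
  reduce x xs (p ∷ ps) (ann ∷ anns , det ∷ dets) with reduce x xs ps (anns , dets)
  ... | inj₁ van with vector p x ℤ.≟ 0ℤ
  ...   | yes px≡0 = inj₁ (px≡0 ∷ van)
  ...   | no  px≢0 = inj₂ record
    { reduced    = ps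
    ; pivot      = vector p
    ; pivot≢0    = px≢0
    ; preserves  = λ { f (h ∷ hs) → h , hs }
    ; triangular = anns , dets
    ; vanishing  = van
    ; length-red = refl
    }
  reduce x xs (p ∷ ps) (ann ∷ anns , det ∷ dets) | inj₂ r = inj₂ record
    { reduced    = p′ ∷ reduced
    ; pivot      = pivot
    ; pivot≢0    = pivot≢0
    ; preserves  = λ { f (h ∷ hs) → let kw , kq = preserves f hs in
                         kw , trans (combine f) (trans (cong₂ (λ s t → pivot x ℤ.* s ℤ.+ ℤ.- vector p x ℤ.* t) h kw)
                                                       (zeroes (pivot x) (vector p x))) ∷ kq }
    ; triangular = (proj₂ (preserves (functional p) ann) ∷ proj₁ triangular)
                 , (λ eq → *-≢0 pivot≢0 det (trans (sym detect) eq)) ∷ proj₂ triangular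
    ; vanishing  = cancels (pivot x) (vector p x) ∷ vanishing
    ; length-red = cong suc length-red
    }
    where
    open Reduction r
    -- Elimination by cross-multiplication, as ℤ has no division; the factor `pivot x` is nonzero,
    -- so detection survives.
    p′ : Test
    p′ = test (key p) (functional p) (λ y → pivot x ℤ.* vector p y ℤ.+ ℤ.- vector p x ℤ.* pivot y)
    combine : ∀ f → ⟨ f ∣ x ∷ xs ∣ vector p′ ⟩
            ≡ pivot x ℤ.* ⟨ f ∣ x ∷ xs ∣ vector p ⟩ ℤ.+ ℤ.- vector p x ℤ.* ⟨ f ∣ x ∷ xs ∣ pivot ⟩
    combine f = ⟨⟩-linear f (x ∷ xs) (pivot x) (vector p) (ℤ.- vector p x) pivot
    zeroes : ∀ s t → s ℤ.* 0ℤ ℤ.+ ℤ.- t ℤ.* 0ℤ ≡ 0ℤ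
    zeroes = solve-∀
    cancels : ∀ s t → s ℤ.* t ℤ.+ ℤ.- t ℤ.* s ≡ 0ℤ
    cancels = solve-∀
    drop-right : ∀ s t u → s ℤ.* u ℤ.+ ℤ.- t ℤ.* 0ℤ ≡ s ℤ.* u
    drop-right = solve-∀
    detect : ⟨ functional p ∣ x ∷ xs ∣ vector p′ ⟩ ≡ pivot x ℤ.* ⟨ functional p ∣ x ∷ xs ∣ vector p ⟩
    detect = trans (combine (functional p))
      (trans (cong (λ t → pivot x ℤ.* ⟨ functional p ∣ x ∷ xs ∣ vector p ⟩ ℤ.+ ℤ.- vector p x ℤ.* t)
                   (proj₁ (preserves (functional p) ann)))
             (drop-right (pivot x) (vector p x) _))

  forget-coordinate : ∀ x xs f q → VanishingAt x q →
    ⟨ f ∣ x ∷ xs ∣ vector q ⟩ ≡ ⟨ f ∣ xs ∣ vector q ⟩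
  forget-coordinate x xs f q qx≡0 =
    trans (cong (λ t → f x ℤ.* t ℤ.+ ⟨ f ∣ xs ∣ vector q ⟩) qx≡0) (lemma (f x) _)
    where
    lemma : ∀ s t → s ℤ.* 0ℤ ℤ.+ t ≡ t
    lemma = solve-∀

  Triangular-forget : ∀ x xs ps → All (VanishingAt x) ps → Triangular (x ∷ xs) ps → Triangular xs ps
  Triangular-forget x xs []       _          _ = [] , []
  Triangular-forget x xs (p ∷ ps) (z ∷ zs) (ann ∷ anns , det ∷ dets) =
    let anns′ , dets′ = Triangular-forget x xs ps zs (anns , dets) in
    All.zipWith (λ {q} (zq , e) → trans (sym (forget-coordinate x xs (functional p) q zq)) e) (zs , ann) ∷ anns′
    , (λ e → det (trans (forget-coordinate x xs (functional p) p z) e)) ∷ dets′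

  -- Induction on the coordinates: clearing the coordinate `x` costs at most one test, and over no
  -- coordinates every pairing is an empty sum, so nothing is detected.
  Triangular⇒length≤ : ∀ xs ps → Triangular xs ps → length ps ≤ length xs
  Triangular⇒length≤ []       []       _                = z≤n
  Triangular⇒length≤ []       (p ∷ ps) (_ , det ∷ _)    = contradiction refl det
  Triangular⇒length≤ (x ∷ xs) ps       tri with reduce x xs ps tri
  ... | inj₁ van = ℕ.m≤n⇒m≤1+n (Triangular⇒length≤ xs ps (Triangular-forget x xs ps van tri))
  ... | inj₂ r   = subst (_≤ suc (length xs)) (sym length-red)
      (s≤s (Triangular⇒length≤ xs reduced (Triangular-forget x xs reduced vanishing triangular)))
      where open Reduction r

  -- Tests with equal keys must annihilate each other both ways, so any order of the ties is
  -- triangular.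
  Compatible : List I → Test → Test → Set
  Compatible xs p q = (key p ≤ key q → Annihilates xs p q) × (key q ≤ key p → Annihilates xs q p)

  -- The relation is symmetric, so it survives sorting by key; sortedness then selects the direction
  -- that a triangular system needs.
  Compatible⇒length≤ : ∀ xs ps → AllPairs (Compatible xs) ps → All (Detects xs) ps → length ps ≤ length xs
  Compatible⇒length≤ xs ps com det = subst (_≤ length xs) (↭-length (sort-↭ ps))
    (Triangular⇒length≤ xs (sort ps)
      ( AllPairs.zipWith (λ ((f , _) , ≤) → f ≤) (com′ , Linked⇒AllPairs ℕ.≤-trans (sort-↗ ps))
      , All-resp-↭ (↭-sym (sort-↭ ps)) det))
    where
    open Sort (On.decTotalOrder ℕ.≤-decTotalOrder key)
    com′ : AllPairs (Compatible xs) (sort ps)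
    com′ = Permutationₛ.AllPairs-resp-↭ (setoid Test) (λ (f , g) → g , f)
             ((λ { refl c → c }) , (λ { refl c → c })) (↭⇒↭ₛ (↭-sym (sort-↭ ps))) com

-- Counting over k-subsets

𝟙[_⊆_] : ∀ {n} → Subset n → Subset n → ℤ
𝟙[ []          ⊆ []          ] = 1ℤ
𝟙[ outside ∷ A ⊆ _       ∷ B ] = 𝟙[ A ⊆ B ]
𝟙[ inside  ∷ A ⊆ outside ∷ B ] = 0ℤ
𝟙[ inside  ∷ A ⊆ inside  ∷ B ] = 𝟙[ A ⊆ B ]

kSubsets : ∀ n → ℕ → List (Subset n)
kSubsets zero    zero    = [] ∷ []
kSubsets zero    (suc k) = []
kSubsets (suc n) zero    = map (outside ∷_) (kSubsets n zero)
kSubsets (suc n) (suc k) = map (outside ∷_) (kSubsets n (suc k)) ++ map (inside ∷_) (kSubsets n k)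

length-kSubsets : ∀ n k → length (kSubsets n k) ≡ n C k
length-kSubsets zero    zero    = refl
length-kSubsets zero    (suc k) = sym (k>n⇒nCk≡0 (s≤s (z≤n {k})))
length-kSubsets (suc n) zero    = trans (length-map (outside ∷_) (kSubsets n zero)) (length-kSubsets n zero)
length-kSubsets (suc n) (suc k) = begin
  length (map (outside ∷_) (kSubsets n (suc k)) ++ map (inside ∷_) (kSubsets n k))
    ≡⟨ length-++ (map (outside ∷_) (kSubsets n (suc k))) ⟩
  length (map (outside ∷_) (kSubsets n (suc k))) ℕ.+ length (map (inside ∷_) (kSubsets n k))
    ≡⟨ cong₂ ℕ._+_ (length-map (outside ∷_) (kSubsets n (suc k))) (length-map (inside ∷_) (kSubsets n k)) ⟩
  length (kSubsets n (suc k)) ℕ.+ length (kSubsets n k)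
    ≡⟨ cong₂ ℕ._+_ (length-kSubsets n (suc k)) (length-kSubsets n k) ⟩
  n C suc k ℕ.+ n C k
    ≡⟨ ℕ.+-comm (n C suc k) _ ⟩
  n C k ℕ.+ n C suc k
    ≡⟨ nCk+nC[k+1]≡[n+1]C[k+1] n k ⟩
  suc n C suc k ∎
  where open ≡-Reasoning

∑-outside : ∀ n f → ∑ (kSubsets (suc n) zero) f ≡ ∑ (kSubsets n zero) (f ∘ (outside ∷_))
∑-outside n f = ∑-map (outside ∷_) (kSubsets n zero) f

∑-split : ∀ n k f → ∑ (kSubsets (suc n) (suc k)) f
        ≡ ∑ (kSubsets n (suc k)) (f ∘ (outside ∷_)) ℤ.+ ∑ (kSubsets n k) (f ∘ (inside ∷_))
∑-split n k f = trans (∑-++ (map (outside ∷_) (kSubsets n (suc k))) _ f)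
  (cong₂ ℤ._+_ (∑-map (outside ∷_) (kSubsets n (suc k)) f) (∑-map (inside ∷_) (kSubsets n k) f))

kSubsets-∅ : ∀ n k → n < k → ∀ f → ∑ (kSubsets n k) f ≡ 0ℤ
kSubsets-∅ zero    (suc k) _         f = refl
kSubsets-∅ (suc n) (suc k) (s≤s n<k) f = trans (∑-split n k f)
  (cong₂ ℤ._+_ (kSubsets-∅ n (suc k) (ℕ.m<n⇒m<1+n n<k) _) (kSubsets-∅ n k n<k _))

∑-∁ : ∀ n k k′ → k ℕ.+ k′ ≡ n → ∀ f → ∑ (kSubsets n k) f ≡ ∑ (kSubsets n k′) (f ∘ ∁)
∑-∁ zero    zero    zero     refl f = refl
∑-∁ (suc n) zero    (suc k′) refl f = begin
  ∑ (kSubsets (suc n) zero) f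
    ≡⟨ ∑-outside n f ⟩
  ∑ (kSubsets n zero) (f ∘ (outside ∷_))
    ≡⟨ ∑-∁ n zero n refl _ ⟩
  ∑ (kSubsets n n) (f ∘ ∁ ∘ (inside ∷_))
    ≡⟨ ℤ.+-identityˡ _ ⟨
  0ℤ ℤ.+ ∑ (kSubsets n n) (f ∘ ∁ ∘ (inside ∷_))
    ≡⟨ cong (ℤ._+ ∑ (kSubsets n n) (f ∘ ∁ ∘ (inside ∷_))) (kSubsets-∅ n (suc n) ℕ.≤-refl (f ∘ ∁ ∘ (outside ∷_))) ⟨
  ∑ (kSubsets n (suc n)) (f ∘ ∁ ∘ (outside ∷_)) ℤ.+ ∑ (kSubsets n n) (f ∘ ∁ ∘ (inside ∷_))
    ≡⟨ ∑-split n n (f ∘ ∁) ⟨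
  ∑ (kSubsets (suc n) (suc n)) (f ∘ ∁) ∎
  where open ≡-Reasoning
∑-∁ (suc n) (suc k) zero     eq f = begin
  ∑ (kSubsets (suc n) (suc k)) f
    ≡⟨ ∑-split n k f ⟩
  ∑ (kSubsets n (suc k)) (f ∘ (outside ∷_)) ℤ.+ ∑ (kSubsets n k) (f ∘ (inside ∷_))
    ≡⟨ cong (ℤ._+ ∑ (kSubsets n k) (f ∘ (inside ∷_))) (kSubsets-∅ n (suc k) n<1+k (f ∘ (outside ∷_))) ⟩
  0ℤ ℤ.+ ∑ (kSubsets n k) (f ∘ (inside ∷_))
    ≡⟨ ℤ.+-identityˡ _ ⟩
  ∑ (kSubsets n k) (f ∘ (inside ∷_))
    ≡⟨ ∑-∁ n k zero (ℕ.suc-injective eq) _ ⟩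
  ∑ (kSubsets n zero) (f ∘ ∁ ∘ (outside ∷_))
    ≡⟨ ∑-outside n (f ∘ ∁) ⟨
  ∑ (kSubsets (suc n) zero) (f ∘ ∁) ∎
  where
  open ≡-Reasoning
  n<1+k : n < suc k
  n<1+k = ℕ.≤-reflexive (trans (sym eq) (ℕ.+-identityʳ _))
∑-∁ (suc n) (suc k) (suc k′) eq f = begin
  ∑ (kSubsets (suc n) (suc k)) f
    ≡⟨ ∑-split n k f ⟩
  ∑ (kSubsets n (suc k)) (f ∘ (outside ∷_)) ℤ.+ ∑ (kSubsets n k) (f ∘ (inside ∷_))
    ≡⟨ cong₂ ℤ._+_ (∑-∁ n (suc k) k′ (trans (sym (ℕ.+-suc k k′)) (ℕ.suc-injective eq)) _)
                   (∑-∁ n k (suc k′) (ℕ.suc-injective eq) _) ⟩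
  ∑ (kSubsets n k′) (f ∘ ∁ ∘ (inside ∷_)) ℤ.+ ∑ (kSubsets n (suc k′)) (f ∘ ∁ ∘ (outside ∷_))
    ≡⟨ ℤ.+-comm (∑ (kSubsets n k′) (f ∘ ∁ ∘ (inside ∷_))) _ ⟩
  ∑ (kSubsets n (suc k′)) (f ∘ ∁ ∘ (outside ∷_)) ℤ.+ ∑ (kSubsets n k′) (f ∘ ∁ ∘ (inside ∷_))
    ≡⟨ ∑-split n k′ (f ∘ ∁) ⟨
  ∑ (kSubsets (suc n) (suc k′)) (f ∘ ∁) ∎
  where open ≡-Reasoning

-- binomialSum d f = Σᵢ (d choose i) f i
binomialSum : ℕ → (ℕ → ℤ) → ℤ
binomialSum zero    f = f zero
binomialSum (suc d) f = binomialSum d λ i → f i ℤ.+ f (suc i)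

binomialSum-cong : ∀ d {f g} → (∀ i → i ≤ d → f i ≡ g i) → binomialSum d f ≡ binomialSum d g
binomialSum-cong zero    eq = eq 0 z≤n
binomialSum-cong (suc d) eq = binomialSum-cong d λ i i≤d → cong₂ ℤ._+_ (eq i (ℕ.m≤n⇒m≤1+n i≤d)) (eq (suc i) (s≤s i≤d))

binomialSum-+ : ∀ d f g → binomialSum d (λ i → f i ℤ.+ g i) ≡ binomialSum d f ℤ.+ binomialSum d g
binomialSum-+ zero    f g = refl
binomialSum-+ (suc d) f g = trans
  (binomialSum-cong d λ i _ → lemma (f i) (g i) (f (suc i)) (g (suc i)))
  (binomialSum-+ d _ _)
  where
  lemma : ∀ a b c d → (a ℤ.+ b) ℤ.+ (c ℤ.+ d) ≡ (a ℤ.+ c) ℤ.+ (b ℤ.+ d)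
  lemma = solve-∀

binomialSum-* : ∀ d t f → binomialSum d (λ i → t ℤ.* f i) ≡ t ℤ.* binomialSum d f
binomialSum-* zero    t f = refl
binomialSum-* (suc d) t f = trans
  (binomialSum-cong d λ i _ → sym (ℤ.*-distribˡ-+ t (f i) (f (suc i))))
  (binomialSum-* d t _)

-- C∸ m k i = (m choose k - i), and 0 when k < i.
C∸ : ℕ → ℕ → ℕ → ℕ
C∸ m k       zero    = m C k
C∸ m zero    (suc i) = 0
C∸ m (suc k) (suc i) = C∸ m k i

C∸-suc : ∀ m k i → C∸ (suc m) (suc k) i ≡ C∸ m (suc k) i ℕ.+ C∸ m k i
C∸-suc m k       zero          = trans (sym (nCk+nC[k+1]≡[n+1]C[k+1] m k)) (ℕ.+-comm (m C k) _)
C∸-suc m zero    (suc zero)    = refl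
C∸-suc m zero    (suc (suc i)) = refl
C∸-suc m (suc k) (suc i)       = C∸-suc m k i

C∸-zero : ∀ m i → C∸ (suc m) zero i ≡ C∸ m zero i
C∸-zero m zero    = refl
C∸-zero m (suc i) = refl

C∸-+ : ∀ m i q → C∸ m (i ℕ.+ q) i ≡ m C q
C∸-+ m zero    q = refl
C∸-+ m (suc i) q = C∸-+ m i q

-- A `k`-subset `T` of `B` consists of i elements of `B ─ A` and k - i elements of `A ∩ B`, and the
-- weight sees only i. Along the coordinates, an element of `B ─ A` is one Pascal step of
-- `binomialSum`, and an element of `A ∩ B` one Pascal step of `C∸`.
count-subsets : ∀ n k (A B : Subset n) (w : ℕ → ℤ) →
  ∑ (kSubsets n k) (λ T → w ∣ T ─ A ∣ ℤ.* 𝟙[ T ⊆ B ])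
  ≡ binomialSum ∣ B ─ A ∣ (λ i → + C∸ ∣ A ∩ B ∣ k i ℤ.* w i)
count-subsets zero zero [] [] w = lemma (w 0)
  where
  lemma : ∀ t → t ℤ.* + 1 ℤ.+ + 0 ≡ + 1 ℤ.* t
  lemma = solve-∀
count-subsets zero (suc k) [] [] w = sym (cong (λ c → + c ℤ.* w 0) (k>n⇒nCk≡0 (s≤s (z≤n {k}))))
count-subsets (suc n) zero (a ∷ A) (b ∷ B) w with a | b
... | outside | outside = trans (∑-outside n _) (count-subsets n zero A B w)
... | inside  | outside = trans (∑-outside n _) (count-subsets n zero A B w)
... | inside  | inside  = trans (∑-outside n _) (trans (count-subsets n zero A B w)
      (binomialSum-cong ∣ B ─ A ∣ λ i _ → cong (λ c → + c ℤ.* w i) (sym (C∸-zero ∣ A ∩ B ∣ i))))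
... | outside | inside  = trans (∑-outside n _) (trans (count-subsets n zero A B w)
      (binomialSum-cong ∣ B ─ A ∣ λ i _ → sym (lemma (+ C∸ ∣ A ∩ B ∣ zero i ℤ.* w i) (w (suc i)))))
  where
  lemma : ∀ s t → s ℤ.+ + 0 ℤ.* t ≡ s
  lemma = solve-∀
count-subsets (suc n) (suc k) (a ∷ A) (b ∷ B) w with a | b
... | outside | outside = trans (∑-split n k _) (trans (cong₂ ℤ._+_ (count-subsets n (suc k) A B w)
      (∑-zero (kSubsets n k) λ T → ℤ.*-zeroʳ (w (suc ∣ T ─ A ∣)))) (ℤ.+-identityʳ _))
... | inside  | outside = trans (∑-split n k _) (trans (cong₂ ℤ._+_ (count-subsets n (suc k) A B w)
      (∑-zero (kSubsets n k) λ T → ℤ.*-zeroʳ (w ∣ T ─ A ∣))) (ℤ.+-identityʳ _))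
... | inside  | inside  = trans (∑-split n k _) (trans (cong₂ ℤ._+_ (count-subsets n (suc k) A B w) (count-subsets n k A B w))
      (trans (sym (binomialSum-+ ∣ B ─ A ∣ _ _))
        (binomialSum-cong ∣ B ─ A ∣ λ i _ → trans (sym (ℤ.*-distribʳ-+ (w i) (+ C∸ ∣ A ∩ B ∣ (suc k) i) (+ C∸ ∣ A ∩ B ∣ k i)))
          (cong (λ c → + c ℤ.* w i) (sym (C∸-suc ∣ A ∩ B ∣ k i))))))
... | outside | inside  = trans (∑-split n k _) (trans
      (cong₂ ℤ._+_ (count-subsets n (suc k) A B w) (count-subsets n k A B (w ∘ suc)))
      (sym (binomialSum-+ ∣ B ─ A ∣ _ _)))

-- Weights and the evaluation of the pairing.

rising : ℕ → ℕ → ℤ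
rising p zero    = 1ℤ
rising p (suc i) = rising p i ℤ.* (+ p ℤ.+ + i)

sign : ℕ → ℤ
sign zero    = 1ℤ
sign (suc i) = ℤ.- sign i

weight : ℕ → ℕ → ℕ → ℤ
weight k p i = sign i ℤ.* + ((k ∸ i) !) ℤ.* rising p i

-- The absorption identity. Over ℤ the factor m - q needs no side condition: it is 0 at q = m, and
-- for q > m both binomials vanish.
C-absorb : ∀ m q → + (m C suc q) ℤ.* + suc q ≡ + (m C q) ℤ.* (+ m ℤ.- + q)
C-absorb zero zero = refl
C-absorb zero (suc q) rewrite k>n⇒nCk≡0 {0} {suc (suc q)} (s≤s z≤n) | k>n⇒nCk≡0 {0} {suc q} (s≤s z≤n) = refl
C-absorb (suc m) zero = trans (cong (λ c → + c ℤ.* 1ℤ) (sym (nCk+nC[k+1]≡[n+1]C[k+1] m 0)))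
   (trans (lemma (+ (m C 1))) (trans (cong (ℤ._+_ 1ℤ) (C-absorb m zero)) (lemma′ (+ m))))
  where
  lemma : ∀ c → (+ 1 ℤ.+ c) ℤ.* + 1 ≡ + 1 ℤ.+ c ℤ.* + 1
  lemma = solve-∀
  lemma′ : ∀ m → + 1 ℤ.+ + 1 ℤ.* (m ℤ.- + 0) ≡ + 1 ℤ.* (+ 1 ℤ.+ m ℤ.- + 0)
  lemma′ = solve-∀
C-absorb (suc m) (suc q) = begin
  + (suc m C suc (suc q)) ℤ.* + suc (suc q)
    ≡⟨ cong (λ c → + c ℤ.* + suc (suc q)) (nCk+nC[k+1]≡[n+1]C[k+1] m (suc q)) ⟨
  (c₁ ℤ.+ c₂) ℤ.* (1ℤ ℤ.+ (1ℤ ℤ.+ + q))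
    ≡⟨ lemma c₁ c₂ (+ q) ⟩
  c₂ ℤ.* (1ℤ ℤ.+ (1ℤ ℤ.+ + q)) ℤ.+ c₁ ℤ.* (1ℤ ℤ.+ + q) ℤ.+ c₁
    ≡⟨ cong₂ (λ s t → s ℤ.+ t ℤ.+ c₁) (C-absorb m (suc q)) (C-absorb m q) ⟩
  c₁ ℤ.* (+ m ℤ.- (1ℤ ℤ.+ + q)) ℤ.+ c₀ ℤ.* (+ m ℤ.- + q) ℤ.+ c₁
    ≡⟨ lemma′ c₀ c₁ (+ m) (+ q) ⟩
  (c₀ ℤ.+ c₁) ℤ.* ((1ℤ ℤ.+ + m) ℤ.- (1ℤ ℤ.+ + q))
    ≡⟨ cong (λ c → + c ℤ.* (+ suc m ℤ.- + suc q)) (nCk+nC[k+1]≡[n+1]C[k+1] m q) ⟩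
  + (suc m C suc q) ℤ.* (+ suc m ℤ.- + suc q) ∎
  where
  open ≡-Reasoning
  c₀ c₁ c₂ : ℤ
  c₀ = + (m C q)
  c₁ = + (m C suc q)
  c₂ = + (m C suc (suc q))
  lemma : ∀ c₁ c₂ q → (c₁ ℤ.+ c₂) ℤ.* (+ 1 ℤ.+ (+ 1 ℤ.+ q)) ≡ c₂ ℤ.* (+ 1 ℤ.+ (+ 1 ℤ.+ q)) ℤ.+ c₁ ℤ.* (+ 1 ℤ.+ q) ℤ.+ c₁
  lemma = solve-∀
  lemma′ : ∀ c₀ c₁ m q → c₁ ℤ.* (m ℤ.- (+ 1 ℤ.+ q)) ℤ.+ c₀ ℤ.* (m ℤ.- q) ℤ.+ c₁ ≡ (c₀ ℤ.+ c₁) ℤ.* ((+ 1 ℤ.+ m) ℤ.- (+ 1 ℤ.+ q))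
  lemma′ = solve-∀

term : ℕ → ℕ → ℕ → ℕ → ℤ
term m k p i = + C∸ m k i ℤ.* weight k p i

term-+ : ∀ m i q p → term m (i ℕ.+ q) p i ≡ + (m C q) ℤ.* (sign i ℤ.* + (q !) ℤ.* rising p i)
term-+ m i q p = cong₂ (λ c t → + c ℤ.* (sign i ℤ.* + (t !) ℤ.* rising p i)) (C∸-+ m i q) (ℕ.m+n∸m≡n i q)

-- The reason for the choice of weights: absorption turns the two terms into multiples of the same
-- expression, with coefficients m - q and -(p + i) where k = i + q, and in their sum m - k - p the
-- index i cancels.
term-Δ : ∀ m k p i → i ≤ k →
  term m (suc k) p i ℤ.+ term m (suc k) p (suc i) ≡ (+ m ℤ.- + k ℤ.- + p) ℤ.* term m k p i
term-Δ m k p i i≤k with ℕ.m≤n⇒∃[o]m+o≡n i≤k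
... | q , refl = begin
  term m (suc (i ℕ.+ q)) p i ℤ.+ term m (suc (i ℕ.+ q)) p (suc i)
    ≡⟨ cong₂ ℤ._+_ (trans (cong (λ k → term m k p i) (sym (ℕ.+-suc i q))) (term-+ m i (suc q) p)) (term-+ m (suc i) q p) ⟩
  + (m C suc q) ℤ.* (sign i ℤ.* + (suc q !) ℤ.* rising p i)
    ℤ.+ + (m C q) ℤ.* (ℤ.- sign i ℤ.* + (q !) ℤ.* (rising p i ℤ.* (+ p ℤ.+ + i)))
    ≡⟨ cong (λ f → + (m C suc q) ℤ.* (sign i ℤ.* f ℤ.* rising p i)
                   ℤ.+ + (m C q) ℤ.* (ℤ.- sign i ℤ.* + (q !) ℤ.* (rising p i ℤ.* (+ p ℤ.+ + i)))) (ℤ.pos-* (suc q) (q !)) ⟩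
  + (m C suc q) ℤ.* (sign i ℤ.* (+ suc q ℤ.* + (q !)) ℤ.* rising p i)
    ℤ.+ + (m C q) ℤ.* (ℤ.- sign i ℤ.* + (q !) ℤ.* (rising p i ℤ.* (+ p ℤ.+ + i)))
    ≡⟨ lemma (+ (m C suc q)) (+ (m C q)) (+ suc q) (sign i) (+ (q !)) (rising p i) (+ p) (+ i) ⟩
  (+ (m C suc q) ℤ.* + suc q) ℤ.* (sign i ℤ.* + (q !) ℤ.* rising p i)
    ℤ.- (+ p ℤ.+ + i) ℤ.* (+ (m C q) ℤ.* (sign i ℤ.* + (q !) ℤ.* rising p i))
    ≡⟨ cong (λ c → c ℤ.* (sign i ℤ.* + (q !) ℤ.* rising p i)
             ℤ.- (+ p ℤ.+ + i) ℤ.* (+ (m C q) ℤ.* (sign i ℤ.* + (q !) ℤ.* rising p i))) (C-absorb m q) ⟩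
  (+ (m C q) ℤ.* (+ m ℤ.- + q)) ℤ.* (sign i ℤ.* + (q !) ℤ.* rising p i)
    ℤ.- (+ p ℤ.+ + i) ℤ.* (+ (m C q) ℤ.* (sign i ℤ.* + (q !) ℤ.* rising p i))
    ≡⟨ lemma′ (+ (m C q)) (+ m) (+ q) (sign i ℤ.* + (q !) ℤ.* rising p i) (+ p) (+ i) ⟩
  (+ m ℤ.- (+ i ℤ.+ + q) ℤ.- + p) ℤ.* (+ (m C q) ℤ.* (sign i ℤ.* + (q !) ℤ.* rising p i))
    ≡⟨ cong (ℤ._*_ (+ m ℤ.- (+ i ℤ.+ + q) ℤ.- + p)) (term-+ m i q p) ⟨
  (+ m ℤ.- + (i ℕ.+ q) ℤ.- + p) ℤ.* term m (i ℕ.+ q) p i ∎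
  where
  open ≡-Reasoning
  lemma : ∀ c′ c q s f r p i → c′ ℤ.* (s ℤ.* (q ℤ.* f) ℤ.* r) ℤ.+ c ℤ.* (ℤ.- s ℤ.* f ℤ.* (r ℤ.* (p ℤ.+ i)))
        ≡ (c′ ℤ.* q) ℤ.* (s ℤ.* f ℤ.* r) ℤ.- (p ℤ.+ i) ℤ.* (c ℤ.* (s ℤ.* f ℤ.* r))
  lemma = solve-∀
  lemma′ : ∀ c m q x p i → (c ℤ.* (m ℤ.- q)) ℤ.* x ℤ.- (p ℤ.+ i) ℤ.* (c ℤ.* x)
         ≡ (m ℤ.- (i ℤ.+ q) ℤ.- p) ℤ.* (c ℤ.* x)
  lemma′ = solve-∀

-- For m = ∣ A ∩ B ∣, d = ∣ B ─ A ∣ and p = ∣ A ∣ - k this is the value of the functional of a large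
-- `A` on the vector of `B`.
pairing : ℕ → ℕ → ℕ → ℕ → ℤ
pairing m d k p = binomialSum d (term m k p)

-- By `term-Δ` one Pascal step takes out a factor that does not depend on i. With m + e = p + suc k
-- it is 1 - e, and repetition gives (1 - e)(2 - e) and so on.
pairing-suc : ∀ m d k p → d ≤ k → pairing m (suc d) (suc k) p ≡ (+ m ℤ.- + k ℤ.- + p) ℤ.* pairing m d k p
pairing-suc m d k p d≤k = trans
  (binomialSum-cong d λ i i≤d → term-Δ m k p i (ℕ.≤-trans i≤d d≤k))
  (binomialSum-* d (+ m ℤ.- + k ℤ.- + p) (term m k p))

pairing-zero : ∀ m k p → pairing m 0 k p ≡ + ((m C k) ℕ.* k !)
pairing-zero m k p = trans (lemma (+ (m C k)) (+ (k !))) (sym (ℤ.pos-* (m C k) (k !)))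
  where
  lemma : ∀ c f → c ℤ.* (+ 1 ℤ.* f ℤ.* + 1) ≡ c ℤ.* f
  lemma = solve-∀

-- Each factor taken out lowers d, k and e together and keeps m + e = p + k. When e reaches 1 the
-- next factor is 0, and e ≤ d ensures that this happens before d runs out.
pairing-vanishes : ∀ m d k p e → d ≤ k → 1 ≤ e → e ≤ d → m ℕ.+ e ≡ p ℕ.+ k → pairing m d k p ≡ 0ℤ
pairing-vanishes m (suc d) (suc k) p (suc zero) (s≤s d≤k) _ _ eq =
  trans (pairing-suc m d k p d≤k) (cong (ℤ._* pairing m d k p) factor≡0)
  where
  m≡p+k : m ≡ p ℕ.+ k
  m≡p+k = ℕ.suc-injective (trans (ℕ.+-comm 1 m) (trans eq (ℕ.+-suc p k)))
  lemma : ∀ p k → (p ℤ.+ k) ℤ.- k ℤ.- p ≡ 0ℤ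
  lemma = solve-∀
  factor≡0 : + m ℤ.- + k ℤ.- + p ≡ 0ℤ
  factor≡0 = trans (cong (λ t → + t ℤ.- + k ℤ.- + p) m≡p+k) (lemma (+ p) (+ k))
pairing-vanishes m (suc d) (suc k) p (suc (suc e)) (s≤s d≤k) _ (s≤s e<d) eq =
  trans (pairing-suc m d k p d≤k)
    (trans (cong (ℤ._*_ (+ m ℤ.- + k ℤ.- + p)) (pairing-vanishes m d k p (suc e) d≤k (s≤s z≤n) e<d eq′))
           (ℤ.*-zeroʳ (+ m ℤ.- + k ℤ.- + p)))
  where
  eq′ : m ℕ.+ suc e ≡ p ℕ.+ k
  eq′ = ℕ.suc-injective (trans (sym (ℕ.+-suc m (suc e))) (trans eq (ℕ.+-suc p k)))

1≤C : ∀ {m k} → k ≤ m → 1 ≤ m C k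
1≤C {m}     {zero}  _         = ℕ.≤-refl
1≤C {suc m} {suc k} (s≤s k≤m) = subst (1 ≤_) (nCk+nC[k+1]≡[n+1]C[k+1] m k) (ℕ.m≤n⇒m≤n+o _ (1≤C k≤m))

C!≢0 : ∀ {m k} → k ≤ m → + ((m C k) ℕ.* k !) ≢ 0ℤ
C!≢0 {m} {k} k≤m eq = ℕ.<⇒≢ (ℕ.*-mono-≤ (1≤C k≤m) (ℕ.1≤n! k)) (sym (ℤ.+-injective eq))

-- Here e = d + 1, so the factors are -d, ..., -1 and none is zero. At d = 0 the equation gives m =
-- (p - 1) + k, so 1 ≤ p makes the remaining falling factorial nonzero.
pairing-detects : ∀ m d k p → d ≤ k → 1 ≤ p → m ℕ.+ suc d ≡ p ℕ.+ k → pairing m d k p ≢ 0ℤ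
pairing-detects m zero k (suc p) _ _ eq = subst (_≢ 0ℤ) (sym (pairing-zero m k (suc p))) (C!≢0 k≤m)
  where
  k≤m : k ≤ m
  k≤m = subst (k ≤_) (ℕ.suc-injective (trans (sym eq) (ℕ.+-comm m 1))) (ℕ.m≤n+m k p)
pairing-detects m (suc d) (suc k) p (s≤s d≤k) 1≤p eq =
  subst (_≢ 0ℤ) (sym (pairing-suc m d k p d≤k))
    (*-≢0 factor≢0 (pairing-detects m d k p d≤k 1≤p eq′))
  where
  eq′ : m ℕ.+ suc d ≡ p ℕ.+ k
  eq′ = ℕ.suc-injective (trans (sym (ℕ.+-suc m (suc d))) (trans eq (ℕ.+-suc p k)))
  lemma : ∀ m d p k → m ℤ.+ (+ 1 ℤ.+ d) ≡ p ℤ.+ k → m ℤ.- k ℤ.- p ≡ ℤ.- (+ 1 ℤ.+ d)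
  lemma m d p k e = trans (rearrange m d p k)
    (trans (cong (λ t → t ℤ.- (p ℤ.+ k) ℤ.- (1ℤ ℤ.+ d)) e) (cancel p k d))
    where
    rearrange : ∀ m d p k → m ℤ.- k ℤ.- p ≡ m ℤ.+ (+ 1 ℤ.+ d) ℤ.- (p ℤ.+ k) ℤ.- (+ 1 ℤ.+ d)
    rearrange = solve-∀
    cancel : ∀ p k d → p ℤ.+ k ℤ.- (p ℤ.+ k) ℤ.- (+ 1 ℤ.+ d) ≡ ℤ.- (+ 1 ℤ.+ d)
    cancel = solve-∀
  factor≢0 : + m ℤ.- + k ℤ.- + p ≢ 0ℤ
  factor≢0 = subst (_≢ 0ℤ) (sym (lemma (+ m) (+ d) (+ p) (+ k) (cong +_ eq′))) λ ()

-- Sizes of set differences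

∣∩∣+∣─∣ : ∀ {n} (A B : Subset n) → ∣ A ∩ B ∣ ℕ.+ ∣ A ─ B ∣ ≡ ∣ A ∣
∣∩∣+∣─∣ []            []            = refl
∣∩∣+∣─∣ (outside ∷ A) (outside ∷ B) = ∣∩∣+∣─∣ A B
∣∩∣+∣─∣ (outside ∷ A) (inside  ∷ B) = ∣∩∣+∣─∣ A B
∣∩∣+∣─∣ (inside  ∷ A) (outside ∷ B) = trans (ℕ.+-suc ∣ A ∩ B ∣ _) (cong suc (∣∩∣+∣─∣ A B))
∣∩∣+∣─∣ (inside  ∷ A) (inside  ∷ B) = cong suc (∣∩∣+∣─∣ A B)

∣∩∣-comm : ∀ {n} (A B : Subset n) → ∣ A ∩ B ∣ ≡ ∣ B ∩ A ∣
∣∩∣-comm []            []            = refl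
∣∩∣-comm (outside ∷ A) (outside ∷ B) = ∣∩∣-comm A B
∣∩∣-comm (outside ∷ A) (inside  ∷ B) = ∣∩∣-comm A B
∣∩∣-comm (inside  ∷ A) (outside ∷ B) = ∣∩∣-comm A B
∣∩∣-comm (inside  ∷ A) (inside  ∷ B) = cong suc (∣∩∣-comm A B)

∣∩∣+∣─∣ʳ : ∀ {n} (A B : Subset n) → ∣ A ∩ B ∣ ℕ.+ ∣ B ─ A ∣ ≡ ∣ B ∣
∣∩∣+∣─∣ʳ A B = trans (cong (ℕ._+ ∣ B ─ A ∣) (∣∩∣-comm A B)) (∣∩∣+∣─∣ B A)

∣─∣-self : ∀ {n} (A : Subset n) → ∣ A ─ A ∣ ≡ 0
∣─∣-self []            = refl
∣─∣-self (outside ∷ A) = ∣─∣-self A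
∣─∣-self (inside  ∷ A) = ∣─∣-self A

∣─∣-triangle : ∀ {n} (A B D : Subset n) → ∣ A ─ D ∣ ≤ ∣ A ─ B ∣ ℕ.+ ∣ B ─ D ∣
∣─∣-triangle []            []            []            = z≤n
∣─∣-triangle (outside ∷ A) (outside ∷ B) (outside ∷ D) = ∣─∣-triangle A B D
∣─∣-triangle (outside ∷ A) (inside  ∷ B) (outside ∷ D) = ℕ.≤-trans (∣─∣-triangle A B D) (ℕ.+-monoʳ-≤ ∣ A ─ B ∣ (ℕ.n≤1+n _))
∣─∣-triangle (inside  ∷ A) (outside ∷ B) (outside ∷ D) = s≤s (∣─∣-triangle A B D)
∣─∣-triangle (inside  ∷ A) (inside  ∷ B) (outside ∷ D) = subst (suc ∣ A ─ D ∣ ≤_) (sym (ℕ.+-suc ∣ A ─ B ∣ _)) (s≤s (∣─∣-triangle A B D))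
∣─∣-triangle (outside ∷ A) (outside ∷ B) (inside  ∷ D) = ∣─∣-triangle A B D
∣─∣-triangle (outside ∷ A) (inside  ∷ B) (inside  ∷ D) = ∣─∣-triangle A B D
∣─∣-triangle (inside  ∷ A) (outside ∷ B) (inside  ∷ D) = ℕ.m≤n⇒m≤1+n (∣─∣-triangle A B D)
∣─∣-triangle (inside  ∷ A) (inside  ∷ B) (inside  ∷ D) = ∣─∣-triangle A B D

∣∁─∁∣ : ∀ {n} (A B : Subset n) → ∣ ∁ A ─ ∁ B ∣ ≡ ∣ B ─ A ∣
∣∁─∁∣ []            []            = refl
∣∁─∁∣ (outside ∷ A) (outside ∷ B) = ∣∁─∁∣ A B
∣∁─∁∣ (outside ∷ A) (inside  ∷ B) = cong suc (∣∁─∁∣ A B)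
∣∁─∁∣ (inside  ∷ A) (outside ∷ B) = ∣∁─∁∣ A B
∣∁─∁∣ (inside  ∷ A) (inside  ∷ B) = ∣∁─∁∣ A B

∣─∁∣ : ∀ {n} (A B : Subset n) → ∣ A ─ ∁ B ∣ ≡ ∣ B ─ ∁ A ∣
∣─∁∣ []            []            = refl
∣─∁∣ (outside ∷ A) (outside ∷ B) = ∣─∁∣ A B
∣─∁∣ (outside ∷ A) (inside  ∷ B) = ∣─∁∣ A B
∣─∁∣ (inside  ∷ A) (outside ∷ B) = ∣─∁∣ A B
∣─∁∣ (inside  ∷ A) (inside  ∷ B) = cong suc (∣─∁∣ A B)

∣∁∩∣ : ∀ {n} (A T : Subset n) → ∣ ∁ A ∩ T ∣ ≡ ∣ T ─ A ∣
∣∁∩∣ []            []            = refl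
∣∁∩∣ (outside ∷ A) (outside ∷ T) = ∣∁∩∣ A T
∣∁∩∣ (outside ∷ A) (inside  ∷ T) = cong suc (∣∁∩∣ A T)
∣∁∩∣ (inside  ∷ A) (outside ∷ T) = ∣∁∩∣ A T
∣∁∩∣ (inside  ∷ A) (inside  ∷ T) = ∣∁∩∣ A T

∣∁∣+∣∣ : ∀ {n} (A : Subset n) → ∣ ∁ A ∣ ℕ.+ ∣ A ∣ ≡ n
∣∁∣+∣∣ A = trans (cong (ℕ._+ ∣ A ∣) (∣∁p∣≡n∸∣p∣ A)) (ℕ.m∸n+n≡m (∣p∣≤n A))

∣─∣-≤-swap : ∀ {n} (A B : Subset n) → ∣ A ∣ ≤ ∣ B ∣ → ∣ A ─ B ∣ ≤ ∣ B ─ A ∣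
∣─∣-≤-swap A B A≤B = ℕ.+-cancelˡ-≤ ∣ A ∩ B ∣ _ _
  (subst₂ _≤_ (sym (∣∩∣+∣─∣ A B)) (sym (∣∩∣+∣─∣ʳ A B)) A≤B)

∣─∣-suc-swap : ∀ {n} (X Y : Subset n) → ∣ X ∣ ≡ suc ∣ Y ∣ → ∣ X ─ Y ∣ ≡ suc ∣ Y ─ X ∣
∣─∣-suc-swap X Y eq = ℕ.+-cancelˡ-≡ ∣ X ∩ Y ∣ _ _ (begin
  ∣ X ∩ Y ∣ ℕ.+ ∣ X ─ Y ∣       ≡⟨ ∣∩∣+∣─∣ X Y ⟩
  ∣ X ∣                         ≡⟨ eq ⟩
  suc ∣ Y ∣                     ≡⟨ cong suc (∣∩∣+∣─∣ʳ X Y) ⟨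
  suc (∣ X ∩ Y ∣ ℕ.+ ∣ Y ─ X ∣) ≡⟨ ℕ.+-suc ∣ X ∩ Y ∣ _ ⟨
  ∣ X ∩ Y ∣ ℕ.+ suc ∣ Y ─ X ∣   ∎)
  where open ≡-Reasoning

-- Inclusions are recorded as empty differences so that `∣─∣-triangle` applies to them directly.
superset : ∀ {n} (A : Subset n) → ∣ A ∣ < n → ∃[ X ] ∣ A ─ X ∣ ≡ 0 × ∣ X ∣ ≡ suc ∣ A ∣
superset (outside ∷ A) _ = inside ∷ A , ∣─∣-self A , refl
superset (inside  ∷ A) (s≤s A<n) with superset A A<n
... | X , A⊆X , ∣X∣ = inside ∷ X , A⊆X , cong suc ∣X∣

subset : ∀ {n} (B : Subset n) j → j ≤ ∣ B ∣ → ∃[ Y ] ∣ Y ─ B ∣ ≡ 0 × ∣ Y ∣ ≡ j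
subset []            zero    _ = [] , refl , refl
subset (outside ∷ B) j       j≤B with subset B j j≤B
... | Y , Y⊆B , ∣Y∣ = outside ∷ Y , Y⊆B , ∣Y∣
subset (inside  ∷ B) zero    _ with subset B zero z≤n
... | Y , Y⊆B , ∣Y∣ = outside ∷ Y , Y⊆B , ∣Y∣
subset (inside  ∷ B) (suc j) (s≤s j≤B) with subset B j j≤B
... | Y , Y⊆B , ∣Y∣ = inside ∷ Y , Y⊆B , cong suc ∣Y∣

-- Both factors can be 1 only if A ⊆ T ⊆ B, which `1 ≤ ∣ A ─ B ∣` excludes. This separates a small
-- set from a large one without any weights.
𝟙-chain : ∀ {n} (A T B : Subset n) → 1 ≤ ∣ A ─ B ∣ → 𝟙[ A ⊆ T ] ℤ.* 𝟙[ T ⊆ B ] ≡ 0ℤ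
𝟙-chain []            []            []            ()
𝟙-chain (outside ∷ A) (outside ∷ T) (outside ∷ B) A⊈B = 𝟙-chain A T B A⊈B
𝟙-chain (outside ∷ A) (outside ∷ T) (inside  ∷ B) A⊈B = 𝟙-chain A T B A⊈B
𝟙-chain (outside ∷ A) (inside  ∷ T) (outside ∷ B) A⊈B = ℤ.*-zeroʳ 𝟙[ A ⊆ T ]
𝟙-chain (outside ∷ A) (inside  ∷ T) (inside  ∷ B) A⊈B = 𝟙-chain A T B A⊈B
𝟙-chain (inside  ∷ A) (outside ∷ T) (b       ∷ B) A⊈B = refl
𝟙-chain (inside  ∷ A) (inside  ∷ T) (outside ∷ B) A⊈B = ℤ.*-zeroʳ 𝟙[ A ⊆ T ]
𝟙-chain (inside  ∷ A) (inside  ∷ T) (inside  ∷ B) A⊈B = 𝟙-chain A T B A⊈B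

𝟙-self : ∀ {n} (T : Subset n) → 𝟙[ T ⊆ T ] ≡ 1ℤ
𝟙-self []            = refl
𝟙-self (outside ∷ T) = 𝟙-self T
𝟙-self (inside  ∷ T) = 𝟙-self T

𝟙-∁ : ∀ {n} (A U : Subset n) → 𝟙[ A ⊆ ∁ U ] ≡ 𝟙[ U ⊆ ∁ A ]
𝟙-∁ []            []            = refl
𝟙-∁ (outside ∷ A) (outside ∷ U) = 𝟙-∁ A U
𝟙-∁ (outside ∷ A) (inside  ∷ U) = 𝟙-∁ A U
𝟙-∁ (inside  ∷ A) (outside ∷ U) = 𝟙-∁ A U
𝟙-∁ (inside  ∷ A) (inside  ∷ U) = refl

-- Vectors and functionals of large and small sets

weightOn : ∀ {n} → ℕ → Subset n → Subset n → ℤ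
weightOn k A T = weight k (∣ A ∣ ∸ k) ∣ T ─ A ∣

⟨weightOn∣𝟙⟩ : ∀ n k (A B : Subset n) →
  ⟨ weightOn k A ∣ kSubsets n k ∣ 𝟙[_⊆ B ] ⟩ ≡ pairing (∣ A ∩ B ∣) (∣ B ─ A ∣) k (∣ A ∣ ∸ k)
⟨weightOn∣𝟙⟩ n k A B = count-subsets n k A B (weight k (∣ A ∣ ∸ k))

module _ {n} (k : ℕ) (A B : Subset n) (k≤A : k ≤ ∣ A ∣) where

  private
    size : ∣ A ∣ ≡ (∣ A ∣ ∸ k) ℕ.+ k
    size = sym (ℕ.m∸n+n≡m k≤A)

  weightOn-annihilates : ∣ A ∣ ≤ ∣ B ∣ → 1 ≤ ∣ A ─ B ∣ → ∣ B ─ A ∣ ≤ k →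
    ⟨ weightOn k A ∣ kSubsets n k ∣ 𝟙[_⊆ B ] ⟩ ≡ 0ℤ
  weightOn-annihilates A≤B A⊈B B─A≤k = trans (⟨weightOn∣𝟙⟩ n k A B)
    (pairing-vanishes _ _ k (∣ A ∣ ∸ k) _ B─A≤k A⊈B (∣─∣-≤-swap A B A≤B)
      (trans (∣∩∣+∣─∣ A B) size))

  -- A size gap of one gives e = d + 1, and k < ∣ A ∣ gives p ≥ 1. This is the source of the
  -- additional test for families of mixed sizes.
  weightOn-detects-smaller : k < ∣ A ∣ → ∣ A ∣ ≡ suc ∣ B ∣ → ∣ B ─ A ∣ ≤ k →
    ⟨ weightOn k A ∣ kSubsets n k ∣ 𝟙[_⊆ B ] ⟩ ≢ 0ℤ
  weightOn-detects-smaller k<A eq B─A≤k = subst (_≢ 0ℤ) (sym (⟨weightOn∣𝟙⟩ n k A B))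
    (pairing-detects _ _ k (∣ A ∣ ∸ k) B─A≤k (ℕ.m<n⇒0<n∸m k<A)
      (trans (cong (∣ A ∩ B ∣ ℕ.+_) (sym (∣─∣-suc-swap A B eq))) (trans (∣∩∣+∣─∣ A B) size)))

weightOn-detects : ∀ {n} k (A : Subset n) → k ≤ ∣ A ∣ →
  ⟨ weightOn k A ∣ kSubsets n k ∣ 𝟙[_⊆ A ] ⟩ ≢ 0ℤ
weightOn-detects {n} k A k≤A = subst (_≢ 0ℤ) (sym value) (C!≢0 k≤A)
  where
  value : ⟨ weightOn k A ∣ kSubsets n k ∣ 𝟙[_⊆ A ] ⟩ ≡ + ((∣ A ∣ C k) ℕ.* k !)
  value = trans (⟨weightOn∣𝟙⟩ n k A A)
    (trans (cong₂ (λ m d → pairing m d k (∣ A ∣ ∸ k))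
             (trans (sym (ℕ.+-identityʳ _)) (trans (cong (∣ A ∩ A ∣ ℕ.+_) (sym (∣─∣-self A))) (∣∩∣+∣─∣ A A)))
             (∣─∣-self A))
           (pairing-zero ∣ A ∣ k (∣ A ∣ ∸ k)))

-- Here `k` is the size of the complements `∁ T`. Complementing exchanges the two sides of the
-- pairing, so these weights serve as a vector.
coweightOn : ∀ {n} → ℕ → Subset n → Subset n → ℤ
coweightOn k B T = weightOn k (∁ B) (∁ T)

-- A ⊆ ∁ U means U ⊆ ∁ A, so the pair (A, B) becomes (∁ B, ∁ A). The swap undoes the reversal of
-- sizes, and both differences keep their sizes.
⟨𝟙∣coweightOn⟩ : ∀ n k k′ → k ℕ.+ k′ ≡ n → (A B : Subset n) →
  ⟨ 𝟙[ A ⊆_] ∣ kSubsets n k ∣ coweightOn k′ B ⟩ ≡ ⟨ weightOn k′ (∁ B) ∣ kSubsets n k′ ∣ 𝟙[_⊆ ∁ A ] ⟩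
⟨𝟙∣coweightOn⟩ n k k′ eq A B = trans (∑-∁ n k k′ eq _) (∑-cong (kSubsets n k′) λ U →
  trans (cong₂ ℤ._*_ (𝟙-∁ A U) (cong (weight k′ (∣ ∁ B ∣ ∸ k′)) (trans (∣∁─∁∣ (∁ U) B) (∣─∁∣ B U))))
        (ℤ.*-comm 𝟙[ U ⊆ ∁ A ] _))

module _ {n} (k k′ : ℕ) (k+k′≡n : k ℕ.+ k′ ≡ n) (A B : Subset n) where

  private
    ≤-∁ : ∀ (D E : Subset n) → ∣ D ∣ ≤ ∣ E ∣ → ∣ ∁ E ∣ ≤ ∣ ∁ D ∣
    ≤-∁ D E D≤E = subst₂ _≤_ (sym (∣∁p∣≡n∸∣p∣ E)) (sym (∣∁p∣≡n∸∣p∣ D)) (ℕ.∸-monoʳ-≤ n D≤E)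

    k′≤ : ∀ (D : Subset n) → ∣ D ∣ ≤ k → k′ ≤ ∣ ∁ D ∣
    k′≤ D D≤k = ℕ.+-cancelʳ-≤ ∣ D ∣ _ _ (subst (k′ ℕ.+ ∣ D ∣ ≤_) (trans (ℕ.+-comm k′ k) (trans k+k′≡n (sym (∣∁∣+∣∣ D)))) (ℕ.+-monoʳ-≤ k′ D≤k))

  coweightOn-annihilates : ∣ A ∣ ≤ ∣ B ∣ → ∣ B ∣ ≤ k → 1 ≤ ∣ A ─ B ∣ → ∣ B ─ A ∣ ≤ k′ →
    ⟨ 𝟙[ A ⊆_] ∣ kSubsets n k ∣ coweightOn k′ B ⟩ ≡ 0ℤ
  coweightOn-annihilates A≤B B≤k A⊈B B─A≤k′ = trans (⟨𝟙∣coweightOn⟩ n k k′ k+k′≡n A B)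
    (weightOn-annihilates k′ (∁ B) (∁ A) (k′≤ B B≤k) (≤-∁ A B A≤B)
      (subst (1 ≤_) (sym (∣∁─∁∣ B A)) A⊈B) (subst (_≤ k′) (sym (∣∁─∁∣ A B)) B─A≤k′))

  coweightOn-detects-larger : ∣ B ∣ < k → ∣ A ∣ ≡ suc ∣ B ∣ → ∣ B ─ A ∣ ≤ k′ →
    ⟨ 𝟙[ A ⊆_] ∣ kSubsets n k ∣ coweightOn k′ B ⟩ ≢ 0ℤ
  coweightOn-detects-larger B<k eq B─A≤k′ = subst (_≢ 0ℤ) (sym (⟨𝟙∣coweightOn⟩ n k k′ k+k′≡n A B))
    (weightOn-detects-smaller k′ (∁ B) (∁ A) (ℕ.<⇒≤ k′<∁B) k′<∁B
      sizes (subst (_≤ k′) (sym (∣∁─∁∣ A B)) B─A≤k′))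
    where
    sizes : ∣ ∁ B ∣ ≡ suc ∣ ∁ A ∣
    sizes = ℕ.+-cancelʳ-≡ ∣ B ∣ _ _ (trans (∣∁∣+∣∣ B) (trans (sym (∣∁∣+∣∣ A)) (trans (cong (∣ ∁ A ∣ ℕ.+_) eq) (ℕ.+-suc ∣ ∁ A ∣ ∣ B ∣))))
    k′<∁B : k′ < ∣ ∁ B ∣
    k′<∁B = subst (k′ <_) (sym sizes) (s≤s (k′≤ A (subst (_≤ k) (sym eq) B<k)))

coweightOn-detects : ∀ {n} k k′ → k ℕ.+ k′ ≡ n → (A : Subset n) → ∣ A ∣ ≤ k →
  ⟨ 𝟙[ A ⊆_] ∣ kSubsets n k ∣ coweightOn k′ A ⟩ ≢ 0ℤ
coweightOn-detects {n} k k′ eq A A≤k = subst (_≢ 0ℤ) (sym (⟨𝟙∣coweightOn⟩ n k k′ eq A A))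
  (weightOn-detects k′ (∁ A) k′≤)
  where
  k′≤ : k′ ≤ ∣ ∁ A ∣
  k′≤ = subst₂ _≤_ (trans (cong (_∸ k) (sym eq)) (ℕ.m+n∸m≡n k k′)) (sym (∣∁p∣≡n∸∣p∣ A)) (ℕ.∸-monoʳ-≤ n A≤k)

-- The test at a k-subset

∑-adjoin : ∀ {n} → Subset n → (Subset n → ℤ) → ℤ
∑-adjoin []            h = 0ℤ
∑-adjoin (outside ∷ T) h = h (inside ∷ T) ℤ.+ ∑-adjoin T (h ∘ (outside ∷_))
∑-adjoin (inside  ∷ T) h = ∑-adjoin T (h ∘ (inside ∷_))

∑-adjoin-cong : ∀ {n} (T : Subset n) {g h} →
  (∀ Y → ∣ Y ∣ ≡ suc ∣ T ∣ → g Y ≡ h Y) → ∑-adjoin T g ≡ ∑-adjoin T h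
∑-adjoin-cong []            eq = refl
∑-adjoin-cong (outside ∷ T) eq = cong₂ ℤ._+_ (eq _ refl) (∑-adjoin-cong T λ Y → eq (outside ∷ Y))
∑-adjoin-cong (inside  ∷ T) eq = ∑-adjoin-cong T λ Y e → eq (inside ∷ Y) (cong suc e)

∑-adjoin-0 : ∀ {n} (T : Subset n) → ∑-adjoin T (λ _ → 0ℤ) ≡ 0ℤ
∑-adjoin-0 []            = refl
∑-adjoin-0 (outside ∷ T) = trans (ℤ.+-identityˡ _) (∑-adjoin-0 T)
∑-adjoin-0 (inside  ∷ T) = ∑-adjoin-0 T

∑-adjoin-linear : ∀ {n} (T : Subset n) t g h →
  ∑-adjoin T (λ Y → t ℤ.* g Y ℤ.+ h Y) ≡ t ℤ.* ∑-adjoin T g ℤ.+ ∑-adjoin T h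
∑-adjoin-linear []            t g h = lemma t
  where
  lemma : ∀ t → 0ℤ ≡ t ℤ.* 0ℤ ℤ.+ 0ℤ
  lemma = solve-∀
∑-adjoin-linear (outside ∷ T) t g h =
  trans (cong (ℤ._+_ (t ℤ.* g (inside ∷ T) ℤ.+ h (inside ∷ T))) (∑-adjoin-linear T t _ _))
        (lemma t (g (inside ∷ T)) (h (inside ∷ T)) _ _)
  where
  lemma : ∀ t a b c d → t ℤ.* a ℤ.+ b ℤ.+ (t ℤ.* c ℤ.+ d) ≡ t ℤ.* (a ℤ.+ c) ℤ.+ (b ℤ.+ d)
  lemma = solve-∀
∑-adjoin-linear (inside  ∷ T) t g h = ∑-adjoin-linear T t _ _

⟨∣∑-adjoin⟩ : ∀ {n a} {I : Set a} (f : I → ℤ) (xs : List I) (T : Subset n) (v : Subset n → I → ℤ) →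
  ⟨ f ∣ xs ∣ (λ x → ∑-adjoin T (λ Y → v Y x)) ⟩ ≡ ∑-adjoin T (λ Y → ⟨ f ∣ xs ∣ v Y ⟩)
⟨∣∑-adjoin⟩ f []       T v = sym (∑-adjoin-0 T)
⟨∣∑-adjoin⟩ f (x ∷ xs) T v = trans
  (cong (ℤ._+_ (f x ℤ.* ∑-adjoin T (λ Y → v Y x))) (⟨∣∑-adjoin⟩ f xs T v))
  (sym (∑-adjoin-linear T (f x) _ _))

∑-adjoin-𝟙 : ∀ {n} (T : Subset n) → ∑-adjoin T 𝟙[ T ⊆_] ≡ + ∣ ∁ T ∣
∑-adjoin-𝟙 []            = refl
∑-adjoin-𝟙 (outside ∷ T) = cong₂ ℤ._+_ (𝟙-self T) (∑-adjoin-𝟙 T)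
∑-adjoin-𝟙 (inside  ∷ T) = ∑-adjoin-𝟙 T

-- The adjoined element lies either in `A ─ T`, where it enlarges the intersection, or in `∁ A ─ T`,
-- where it enlarges the difference.
∑-adjoin-sizes : ∀ {n} (A T : Subset n) (ψ : ℕ → ℕ → ℤ) →
  ∑-adjoin T (λ Y → ψ (∣ A ∩ Y ∣) (∣ Y ─ A ∣))
  ≡ + ∣ A ─ T ∣ ℤ.* ψ (suc ∣ A ∩ T ∣) (∣ T ─ A ∣) ℤ.+ + ∣ ∁ A ─ T ∣ ℤ.* ψ (∣ A ∩ T ∣) (suc ∣ T ─ A ∣)
∑-adjoin-sizes []            []            ψ = refl
∑-adjoin-sizes (outside ∷ A) (outside ∷ T) ψ =
  trans (cong (ℤ._+_ (ψ (∣ A ∩ T ∣) (suc ∣ T ─ A ∣))) (∑-adjoin-sizes A T ψ))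
        (lemma (+ ∣ A ─ T ∣) (+ ∣ ∁ A ─ T ∣) (ψ (suc ∣ A ∩ T ∣) (∣ T ─ A ∣)) _)
  where
  lemma : ∀ a b x y → y ℤ.+ (a ℤ.* x ℤ.+ b ℤ.* y) ≡ a ℤ.* x ℤ.+ (+ 1 ℤ.+ b) ℤ.* y
  lemma = solve-∀
∑-adjoin-sizes (outside ∷ A) (inside  ∷ T) ψ = ∑-adjoin-sizes A T λ m d → ψ m (suc d)
∑-adjoin-sizes (inside  ∷ A) (outside ∷ T) ψ =
  trans (cong (ℤ._+_ (ψ (suc ∣ A ∩ T ∣) (∣ T ─ A ∣))) (∑-adjoin-sizes A T ψ))
        (lemma (+ ∣ A ─ T ∣) (+ ∣ ∁ A ─ T ∣) (ψ (suc ∣ A ∩ T ∣) (∣ T ─ A ∣)) _)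
  where
  lemma : ∀ a b x y → x ℤ.+ (a ℤ.* x ℤ.+ b ℤ.* y) ≡ (+ 1 ℤ.+ a) ℤ.* x ℤ.+ b ℤ.* y
  lemma = solve-∀
∑-adjoin-sizes (inside  ∷ A) (inside  ∷ T) ψ = ∑-adjoin-sizes A T λ m d → ψ (suc m) d

∑-⊇-too-small : ∀ {n} (T : Subset n) k → k < ∣ T ∣ → (h : Subset n → ℤ) →
  ∑ (kSubsets n k) (λ T′ → 𝟙[ T ⊆ T′ ] ℤ.* h T′) ≡ 0ℤ
∑-⊇-too-small {suc n} (outside ∷ T) zero    k<T h =
  trans (∑-outside n _) (∑-⊇-too-small T zero k<T (h ∘ (outside ∷_)))
∑-⊇-too-small {suc n} (inside  ∷ T) zero    k<T h =
  trans (∑-outside n (λ T′ → 𝟙[ inside ∷ T ⊆ T′ ] ℤ.* h T′)) (∑-zero (kSubsets n zero) λ _ → refl)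
∑-⊇-too-small {suc n} (outside ∷ T) (suc k) k<T h =
  trans (∑-split n k (λ T′ → 𝟙[ outside ∷ T ⊆ T′ ] ℤ.* h T′))
    (cong₂ ℤ._+_ (∑-⊇-too-small T (suc k) k<T (h ∘ (outside ∷_))) (∑-⊇-too-small T k (ℕ.<⇒≤ k<T) (h ∘ (inside ∷_))))
∑-⊇-too-small {suc n} (inside  ∷ T) (suc k) (s≤s k<T) h =
  trans (∑-split n k (λ T′ → 𝟙[ inside ∷ T ⊆ T′ ] ℤ.* h T′))
    (cong₂ ℤ._+_ (∑-zero (kSubsets n (suc k)) λ _ → refl) (∑-⊇-too-small T k k<T (h ∘ (inside ∷_))))

-- `T` is the only `k`-subset that contains `T`, so the functional `𝟙[ T ⊆_]` is evaluation at `T`.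
∑-point : ∀ {n} (T : Subset n) k → ∣ T ∣ ≡ k → (g : Subset n → ℤ) →
  ∑ (kSubsets n k) (λ T′ → 𝟙[ T ⊆ T′ ] ℤ.* g T′) ≡ g T
∑-point {zero}  []            zero    eq g = lemma (g [])
  where
  lemma : ∀ t → + 1 ℤ.* t ℤ.+ + 0 ≡ t
  lemma = solve-∀
∑-point {suc n} (inside  ∷ T) (suc k) eq g =
  trans (∑-split n k (λ T′ → 𝟙[ inside ∷ T ⊆ T′ ] ℤ.* g T′))
    (trans (cong₂ ℤ._+_ (∑-zero (kSubsets n (suc k)) λ _ → refl) (∑-point T k (ℕ.suc-injective eq) (g ∘ (inside ∷_))))
           (ℤ.+-identityˡ _))
∑-point {suc n} (outside ∷ T) zero    eq g =
  trans (∑-outside n (λ T′ → 𝟙[ outside ∷ T ⊆ T′ ] ℤ.* g T′)) (∑-point T zero eq (g ∘ (outside ∷_)))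
∑-point {suc n} (outside ∷ T) (suc k) eq g =
  trans (∑-split n k (λ T′ → 𝟙[ outside ∷ T ⊆ T′ ] ℤ.* g T′))
    (trans (cong₂ ℤ._+_ (∑-point T (suc k) eq (g ∘ (outside ∷_)))
                        (∑-⊇-too-small T k (ℕ.≤-reflexive (sym eq)) (g ∘ (inside ∷_))))
           (ℤ.+-identityʳ _))

-- The vector β e_T + Σ_{x ∉ T} v_{T ∪ x}, where β is chosen so that the
-- functional of every A ⊇ T with ∣ A ∣ = p + k annihilates it (n = p + k + q).
probe : ∀ {n} → ℕ → ℕ → ℕ → Subset n → Subset n → ℤ
probe k p q T T′ = ℤ.- (+ p ℤ.* (1ℤ ℤ.+ + k) ℤ.+ + q ℤ.* (1ℤ ℤ.- + p)) ℤ.* 𝟙[ T′ ⊆ T ]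
             ℤ.+ 1ℤ ℤ.* ∑-adjoin T (λ Y → 𝟙[ T′ ⊆ Y ])

pairing-in : ∀ k p → pairing (suc k) 0 k p ≡ (1ℤ ℤ.+ + k) ℤ.* + (k !)
pairing-in k p = trans (pairing-zero (suc k) k p) (trans (cong (λ c → + (c ℕ.* k !)) 1+kCk) (ℤ.pos-* (suc k) (k !)))
  where
  1+kCk : suc k C k ≡ suc k
  1+kCk = trans (nCk≡nC[n∸k] (ℕ.n≤1+n k)) (trans (cong (suc k C_) (ℕ.m+n∸n≡m 1 k)) (nC1≡n (suc k)))

pairing-out : ∀ k p → 1 ≤ k → pairing k 1 k p ≡ (1ℤ ℤ.- + p) ℤ.* + (k !)
pairing-out (suc k) p _ = begin
  pairing (suc k) 1 (suc k) p
    ≡⟨ pairing-suc (suc k) 0 k p z≤n ⟩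
  (1ℤ ℤ.+ + k ℤ.- + k ℤ.- + p) ℤ.* pairing (suc k) 0 k p
    ≡⟨ cong₂ ℤ._*_ (lemma (+ k) (+ p)) (trans (pairing-in k p) (sym (ℤ.pos-* (suc k) (k !)))) ⟩
  (1ℤ ℤ.- + p) ℤ.* + (suc k !) ∎
  where
  open ≡-Reasoning
  lemma : ∀ k p → + 1 ℤ.+ k ℤ.- k ℤ.- p ≡ + 1 ℤ.- p
  lemma = solve-∀

pairing-self : ∀ k p → pairing k 0 k p ≡ + (k !)
pairing-self k p = trans (pairing-zero k k p) (cong +_ (trans (cong (ℕ._* k !) (nCn≡1 k)) (ℕ.*-identityˡ (k !))))

-- For T ⊆ A the vector v_T gives k!, each of the p sets T ∪ x with x in `A` gives (k + 1) k!, and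
-- each of the q others gives (1 - p) k!. The coefficient β cancels the total.
weightOn-annihilates-probe : ∀ {n} k p q (A T : Subset n) → 1 ≤ k → ∣ A ∣ ≡ p ℕ.+ k → p ℕ.+ k ℕ.+ q ≡ n →
  ∣ T ∣ ≡ k → ∣ T ─ A ∣ ≡ 0 → ⟨ weightOn k A ∣ kSubsets n k ∣ probe k p q T ⟩ ≡ 0ℤ
weightOn-annihilates-probe {n} k p q A T 1≤k ∣A∣ sizes ∣T∣ T⊆A = begin
  ⟨ weightOn k A ∣ kSubsets n k ∣ probe k p q T ⟩
    ≡⟨ ⟨⟩-linear (weightOn k A) (kSubsets n k) β 𝟙[_⊆ T ] 1ℤ (λ T′ → ∑-adjoin T (λ Y → 𝟙[ T′ ⊆ Y ])) ⟩
  β ℤ.* ⟨ weightOn k A ∣ kSubsets n k ∣ 𝟙[_⊆ T ] ⟩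
    ℤ.+ 1ℤ ℤ.* ⟨ weightOn k A ∣ kSubsets n k ∣ (λ T′ → ∑-adjoin T (λ Y → 𝟙[ T′ ⊆ Y ])) ⟩
    ≡⟨ cong₂ (λ s t → β ℤ.* s ℤ.+ 1ℤ ℤ.* t) at-T at-adjoined ⟩
  β ℤ.* + (k !) ℤ.+ 1ℤ ℤ.* (+ p ℤ.* ((1ℤ ℤ.+ + k) ℤ.* + (k !)) ℤ.+ + q ℤ.* ((1ℤ ℤ.- + p) ℤ.* + (k !)))
    ≡⟨ lemma (+ k) (+ p) (+ q) (+ (k !)) ⟩
  0ℤ ∎
  where
  open ≡-Reasoning
  β : ℤ
  β = ℤ.- (+ p ℤ.* (1ℤ ℤ.+ + k) ℤ.+ + q ℤ.* (1ℤ ℤ.- + p))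
  excess : ∣ A ∣ ∸ k ≡ p
  excess = trans (cong (_∸ k) ∣A∣) (ℕ.m+n∸n≡m p k)
  common : ∣ A ∩ T ∣ ≡ k
  common = trans (sym (ℕ.+-identityʳ _)) (trans (cong (∣ A ∩ T ∣ ℕ.+_) (sym T⊆A)) (trans (∣∩∣+∣─∣ʳ A T) ∣T∣))
  A─T : ∣ A ─ T ∣ ≡ p
  A─T = ℕ.+-cancelˡ-≡ k _ _ (trans (cong (ℕ._+ ∣ A ─ T ∣) (sym common)) (trans (∣∩∣+∣─∣ A T) (trans ∣A∣ (ℕ.+-comm p k))))
  rest : ∣ ∁ A ─ T ∣ ≡ q
  rest = trans (cong (ℕ._+ ∣ ∁ A ─ T ∣) (sym (trans (∣∁∩∣ A T) T⊆A)))
    (trans (∣∩∣+∣─∣ (∁ A) T) (ℕ.+-cancelʳ-≡ ∣ A ∣ _ _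
      (trans (∣∁∣+∣∣ A) (trans (sym sizes) (trans (ℕ.+-comm (p ℕ.+ k) q) (cong (q ℕ.+_) (sym ∣A∣)))))))
  at-T : ⟨ weightOn k A ∣ kSubsets n k ∣ 𝟙[_⊆ T ] ⟩ ≡ + (k !)
  at-T = trans (⟨weightOn∣𝟙⟩ n k A T)
    (trans (cong₂ (λ m d → pairing m d k (∣ A ∣ ∸ k)) common T⊆A) (pairing-self k (∣ A ∣ ∸ k)))
  at-adjoined : ⟨ weightOn k A ∣ kSubsets n k ∣ (λ T′ → ∑-adjoin T (λ Y → 𝟙[ T′ ⊆ Y ])) ⟩
              ≡ + p ℤ.* ((1ℤ ℤ.+ + k) ℤ.* + (k !)) ℤ.+ + q ℤ.* ((1ℤ ℤ.- + p) ℤ.* + (k !))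
  at-adjoined = begin
    ⟨ weightOn k A ∣ kSubsets n k ∣ (λ T′ → ∑-adjoin T (λ Y → 𝟙[ T′ ⊆ Y ])) ⟩
      ≡⟨ ⟨∣∑-adjoin⟩ (weightOn k A) (kSubsets n k) T (λ Y → 𝟙[_⊆ Y ]) ⟩
    ∑-adjoin T (λ Y → ⟨ weightOn k A ∣ kSubsets n k ∣ 𝟙[_⊆ Y ] ⟩)
      ≡⟨ ∑-adjoin-cong T (λ Y _ → ⟨weightOn∣𝟙⟩ n k A Y) ⟩
    ∑-adjoin T (λ Y → pairing (∣ A ∩ Y ∣) (∣ Y ─ A ∣) k (∣ A ∣ ∸ k))
      ≡⟨ ∑-adjoin-sizes A T (λ m d → pairing m d k (∣ A ∣ ∸ k)) ⟩
    + ∣ A ─ T ∣ ℤ.* pairing (suc ∣ A ∩ T ∣) (∣ T ─ A ∣) k (∣ A ∣ ∸ k)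
      ℤ.+ + ∣ ∁ A ─ T ∣ ℤ.* pairing (∣ A ∩ T ∣) (suc ∣ T ─ A ∣) k (∣ A ∣ ∸ k)
      ≡⟨ cong₂ (λ m d → + ∣ A ─ T ∣ ℤ.* pairing (suc m) d k (∣ A ∣ ∸ k)
                 ℤ.+ + ∣ ∁ A ─ T ∣ ℤ.* pairing m (suc d) k (∣ A ∣ ∸ k)) common T⊆A ⟩
    + ∣ A ─ T ∣ ℤ.* pairing (suc k) 0 k (∣ A ∣ ∸ k) ℤ.+ + ∣ ∁ A ─ T ∣ ℤ.* pairing k 1 k (∣ A ∣ ∸ k)
      ≡⟨ cong₂ ℤ._+_ (cong₂ (λ s t → + s ℤ.* t) A─T (pairing-in k (∣ A ∣ ∸ k)))
                     (cong₂ (λ s t → + s ℤ.* t) rest (trans (cong (pairing k 1 k) excess) (pairing-out k p 1≤k))) ⟩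
    + p ℤ.* ((1ℤ ℤ.+ + k) ℤ.* + (k !)) ℤ.+ + q ℤ.* ((1ℤ ℤ.- + p) ℤ.* + (k !)) ∎
  lemma : ∀ k p q f → ℤ.- (p ℤ.* (+ 1 ℤ.+ k) ℤ.+ q ℤ.* (+ 1 ℤ.- p)) ℤ.* f
    ℤ.+ + 1 ℤ.* (p ℤ.* ((+ 1 ℤ.+ k) ℤ.* f) ℤ.+ q ℤ.* ((+ 1 ℤ.- p) ℤ.* f)) ≡ 0ℤ
  lemma = solve-∀

-- At `T` the vector v_T and all p + q enlarged ones are 1, so the value is β + p + q. It is nonzero
-- exactly when the size p + k differs from k and from n - k.
probe-at : ∀ {n} k p q (T : Subset n) → p ℕ.+ k ℕ.+ q ≡ n → ∣ T ∣ ≡ k → probe k p q T T ≡ + p ℤ.* (+ q ℤ.- + k)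
probe-at k p q T sizes ∣T∣ = trans
  (cong₂ (λ s t → ℤ.- (+ p ℤ.* (1ℤ ℤ.+ + k) ℤ.+ + q ℤ.* (1ℤ ℤ.- + p)) ℤ.* s ℤ.+ 1ℤ ℤ.* t) (𝟙-self T) adjoined)
  (lemma (+ k) (+ p) (+ q))
  where
  swap : ∀ p k q → p ℕ.+ k ℕ.+ q ≡ p ℕ.+ q ℕ.+ k
  swap p k q = trans (ℕ.+-assoc p k q) (trans (cong (p ℕ.+_) (ℕ.+-comm k q)) (sym (ℕ.+-assoc p q k)))
  adjoined : ∑-adjoin T 𝟙[ T ⊆_] ≡ + p ℤ.+ + q
  adjoined = trans (∑-adjoin-𝟙 T) (cong +_ (ℕ.+-cancelʳ-≡ k _ _
    (trans (cong (∣ ∁ T ∣ ℕ.+_) (sym ∣T∣)) (trans (∣∁∣+∣∣ T) (trans (sym sizes) (swap p k q))))))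
  lemma : ∀ k p q → ℤ.- (p ℤ.* (+ 1 ℤ.+ k) ℤ.+ q ℤ.* (+ 1 ℤ.- p)) ℤ.* + 1 ℤ.+ + 1 ℤ.* (p ℤ.+ q) ≡ p ℤ.* (q ℤ.- k)
  lemma = solve-∀

-- Differencing families

AllPairs-∈ : ∀ {a r} {I : Set a} {R : I → I → Set r} {xs} → Unique xs →
  (∀ {x y} → x ∈ xs → y ∈ xs → x ≢ y → R x y) → AllPairs R xs
AllPairs-∈ []         r = []
AllPairs-∈ (x∉ ∷ uni) r =
  All.tabulate (λ y∈ → r (here refl) (there y∈) (All.lookup x∉ y∈)) ∷ AllPairs-∈ uni λ x∈ y∈ → r (there x∈) (there y∈)

-- The key is free, so that extra tests can be placed between the members. The decision is an
-- argument, so that proofs can split on it.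
setTest : ∀ {n} k → ℕ → (A : Subset n) → Dec (∣ A ∣ < k) → Test {I = Subset n}
setTest {n} k key A (yes _) = test key 𝟙[ A ⊆_] (coweightOn (n ∸ k) A)
setTest {n} k key A (no  _) = test key (weightOn k A) 𝟙[_⊆ A ]

key-setTest : ∀ {n} k j (A : Subset n) A<k? → key (setTest k j A A<k?) ≡ j
key-setTest k j A (yes _) = refl
key-setTest k j A (no  _) = refl

module _ {n} (k : ℕ) (2k∸1≤n : 2 * k ∸ 1 ≤ n) (1≤k : 1 ≤ k) where

  k≤n : k ≤ n
  k≤n = ℕ.≤-trans (ℕ.+-cancelˡ-≤ 1 _ _ (subst (suc k ≤_) (sym (ℕ.m+[n∸m]≡n (ℕ.≤-trans 1≤k (ℕ.m≤m+n k _))))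
          (subst (λ j → suc k ≤ k ℕ.+ j) (sym (ℕ.+-identityʳ k)) (ℕ.+-monoˡ-≤ k 1≤k)))) 2k∸1≤n

  private
    xs : List (Subset n)
    xs = kSubsets n k

    k+[n∸k]≡n : k ℕ.+ (n ∸ k) ≡ n
    k+[n∸k]≡n = ℕ.m+[n∸m]≡n k≤n

  -- From k + j + 1 ≤ 2k ≤ n + 1. The complementary construction allows differences of size at most
  -- n - k, and for sets with fewer than k elements the bound n ≥ 2k - 1 guarantees this.
  <k⇒≤n∸k : ∀ {j} → j < k → j ≤ n ∸ k
  <k⇒≤n∸k {j} j<k = ℕ.+-cancelˡ-≤ (suc k) _ _ (begin
    suc k ℕ.+ j        ≡⟨ ℕ.+-suc k j ⟨
    k ℕ.+ suc j        ≤⟨ ℕ.+-monoʳ-≤ k j<k ⟩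
    k ℕ.+ k            ≡⟨ cong (k ℕ.+_) (ℕ.+-identityʳ k) ⟨
    2 * k              ≡⟨ ℕ.m+[n∸m]≡n (ℕ.≤-trans 1≤k (ℕ.m≤m+n k _)) ⟨
    1 ℕ.+ (2 * k ∸ 1)  ≤⟨ s≤s 2k∸1≤n ⟩
    suc n              ≡⟨ cong suc k+[n∸k]≡n ⟨
    suc k ℕ.+ (n ∸ k)  ∎)
    where open ℕ.≤-Reasoning

  ─-small : ∀ (A B : Subset n) → ∣ B ∣ < k → ∣ B ─ A ∣ ≤ n ∸ k
  ─-small A B B<k = ℕ.≤-trans (∣p─q∣≤∣p∣ B A) (<k⇒≤n∸k B<k)

  -- Two large sets use the weights, two small ones the weights of the complements, and a small set
  -- before a large one only that `A` is not inside `B`. A large set before a small one contradicts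
  -- the order by size.
  setTest-annihilates : ∀ i j (A B : Subset n) A<k? B<k? → ∣ A ∣ ≤ ∣ B ∣ → 1 ≤ ∣ A ─ B ∣ → ∣ B ─ A ∣ ≤ k →
    Annihilates xs (setTest k i A A<k?) (setTest k j B B<k?)
  setTest-annihilates i j A B (yes A<k) (yes B<k) A≤B A⊈B B─A≤k =
    coweightOn-annihilates k (n ∸ k) k+[n∸k]≡n A B A≤B (ℕ.<⇒≤ B<k) A⊈B (─-small A B B<k)
  setTest-annihilates i j A B (yes A<k) (no  B≮k) A≤B A⊈B B─A≤k = ∑-zero xs λ T → 𝟙-chain A T B A⊈B
  setTest-annihilates i j A B (no  A≮k) (yes B<k) A≤B A⊈B B─A≤k = contradiction (ℕ.≤-<-trans A≤B B<k) A≮k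
  setTest-annihilates i j A B (no  A≮k) (no  B≮k) A≤B A⊈B B─A≤k =
    weightOn-annihilates k A B (ℕ.≮⇒≥ A≮k) A≤B A⊈B B─A≤k

  setTest-detects : ∀ i (A : Subset n) A<k? → Detects xs (setTest k i A A<k?)
  setTest-detects i A (yes A<k) = coweightOn-detects k (n ∸ k) k+[n∸k]≡n A (ℕ.<⇒≤ A<k)
  setTest-detects i A (no  A≮k) = weightOn-detects k A (ℕ.≮⇒≥ A≮k)

  module _ (𝓕 : Family n) (differencing : Differencing k 𝓕) where

    testOf : (Subset n → ℕ) → Subset n → Test
    testOf κ A = setTest k (κ A) A (∣ A ∣ ℕ.<? k)

    key-testOf : ∀ κ A → key (testOf κ A) ≡ κ A
    key-testOf κ A = key-setTest k (κ A) A (∣ A ∣ ℕ.<? k)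

    tests : (Subset n → ℕ) → List Test
    tests κ = map (testOf κ) (members 𝓕)

    tests-detect : ∀ κ → All (Detects xs) (tests κ)
    tests-detect κ = All.map⁺ (All.universal (λ A → setTest-detects (κ A) A (∣ A ∣ ℕ.<? k)) (members 𝓕))

    -- The key need not be the size: it may refine the order by size, and it may order sets of equal
    -- size freely.
    tests-compatible : ∀ κ → (∀ {A B} → A ∈ᶠ 𝓕 → B ∈ᶠ 𝓕 → κ A ≤ κ B → ∣ A ∣ ≤ ∣ B ∣) →
      AllPairs (Compatible xs) (tests κ)
    tests-compatible κ mono = AllPairs.map⁺ (AllPairs-∈ (unique 𝓕) λ A∈ B∈ A≢B →
      compatible A∈ B∈ A≢B , compatible B∈ A∈ (A≢B ∘ sym))
      where
      compatible : ∀ {A B} → A ∈ᶠ 𝓕 → B ∈ᶠ 𝓕 → A ≢ B →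
        key (testOf κ A) ≤ key (testOf κ B) → Annihilates xs (testOf κ A) (testOf κ B)
      compatible {A} {B} A∈ B∈ A≢B p≤q = setTest-annihilates (κ A) (κ B) A B (∣ A ∣ ℕ.<? k) (∣ B ∣ ℕ.<? k)
        (mono A∈ B∈ (subst₂ _≤_ (key-testOf κ A) (key-testOf κ B) p≤q))
        (proj₁ (differencing A B A∈ B∈ A≢B)) (proj₂ (differencing B A B∈ A∈ (A≢B ∘ sym)))

    card≤nCk : card 𝓕 ≤ n C k
    card≤nCk = subst₂ _≤_ (length-map _ (members 𝓕)) (length-kSubsets n k)
      (Compatible⇒length≤ xs (tests ∣_∣) (tests-compatible ∣_∣ (λ _ _ ≤ → ≤)) (tests-detect ∣_∣))

    -- One more compatible test, placed at key `j`, makes card + 1 tests in a space of dimension n C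
    -- k. The conditions are stated for every `A<k?` so that a caller can split on the decision.
    card<nCk : ∀ κ → (∀ {A B} → A ∈ᶠ 𝓕 → B ∈ᶠ 𝓕 → κ A ≤ κ B → ∣ A ∣ ≤ ∣ B ∣) →
      ∀ j f v → ⟨ f ∣ xs ∣ v ⟩ ≢ 0ℤ →
      (∀ {A} A<k? → A ∈ᶠ 𝓕 → j ≤ κ A → ⟨ f ∣ xs ∣ vector (setTest k (κ A) A A<k?) ⟩ ≡ 0ℤ) →
      (∀ {A} A<k? → A ∈ᶠ 𝓕 → κ A ≤ j → ⟨ functional (setTest k (κ A) A A<k?) ∣ xs ∣ v ⟩ ≡ 0ℤ) →
      card 𝓕 < n C k
    card<nCk κ mono j f v det annˡ annʳ = subst₂ _≤_ (cong suc (length-map _ (members 𝓕))) (length-kSubsets n k)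
      (Compatible⇒length≤ xs (test j f v ∷ tests κ)
        (All.map⁺ (All.tabulate λ {A} A∈ →
            (λ ≤ → annˡ (∣ A ∣ ℕ.<? k) A∈ (subst (j ≤_) (key-testOf κ A) ≤)) ,
            (λ ≤ → annʳ (∣ A ∣ ℕ.<? k) A∈ (subst (_≤ j) (key-testOf κ A) ≤)))
          ∷ tests-compatible κ mono)
        (det ∷ tests-detect κ))

    -- `X` is not inside a member of larger size because `A₀` is not, and a member of minimum size
    -- is not inside `Y` because it is not inside `B`. Since ∣ X ∣ = ∣ Y ∣ + 1, the functional of
    -- `X` still detects the vector of `Y`.
    nonuniform⇒card<nCk : ∀ {A₀ B} → A₀ ∈ᶠ 𝓕 → B ∈ᶠ 𝓕 → (∀ {A} → A ∈ᶠ 𝓕 → ∣ A₀ ∣ ≤ ∣ A ∣) →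
      ∣ A₀ ∣ < ∣ B ∣ → card 𝓕 < n C k
    nonuniform⇒card<nCk {A₀} {B} A₀∈ B∈ minimal A₀<B
      with superset A₀ (ℕ.<-≤-trans A₀<B (∣p∣≤n B)) | subset B ∣ A₀ ∣ (ℕ.<⇒≤ A₀<B)
    ... | X , A₀⊆X , ∣X∣ | Y , Y⊆B , ∣Y∣ = by-size (∣ A₀ ∣ ℕ.<? k)
      where
      ≢-by-size : ∀ {A D : Subset n} → ∣ A ∣ < ∣ D ∣ → A ≢ D
      ≢-by-size A<D refl = ℕ.<-irrefl refl A<D

      _⊈ᶠ_ : ∀ {A D} → A ∈ᶠ 𝓕 × D ∈ᶠ 𝓕 → A ≢ D → 1 ≤ ∣ A ─ D ∣
      (A∈ , D∈) ⊈ᶠ A≢D = proj₁ (differencing _ _ A∈ D∈ A≢D)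

      X⊈ : ∀ {A} → A ∈ᶠ 𝓕 → ∣ A₀ ∣ < ∣ A ∣ → 1 ≤ ∣ X ─ A ∣
      X⊈ {A} A∈ A₀<A = ℕ.≤-trans ((A₀∈ , A∈) ⊈ᶠ ≢-by-size A₀<A)
        (subst (λ t → ∣ A₀ ─ A ∣ ≤ t ℕ.+ ∣ X ─ A ∣) A₀⊆X (∣─∣-triangle A₀ X A))

      ─X≤ : ∀ A → ∣ A ─ X ∣ ≤ ∣ A ─ A₀ ∣
      ─X≤ A = subst (∣ A ─ X ∣ ≤_) (trans (cong (∣ A ─ A₀ ∣ ℕ.+_) A₀⊆X) (ℕ.+-identityʳ _)) (∣─∣-triangle A A₀ X)

      A─X≤k : ∀ {A} → A ∈ᶠ 𝓕 → ∣ A₀ ∣ < ∣ A ∣ → ∣ A ─ X ∣ ≤ k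
      A─X≤k {A} A∈ A₀<A = ℕ.≤-trans (─X≤ A) (proj₂ (differencing _ _ A∈ A₀∈ (≢-by-size A₀<A ∘ sym)))

      Y─≤ : ∀ {D} → ∣ Y ─ D ∣ ≤ ∣ B ─ D ∣
      Y─≤ {D} = subst (λ t → ∣ Y ─ D ∣ ≤ t ℕ.+ ∣ B ─ D ∣) Y⊆B (∣─∣-triangle Y B D)

      ⊈Y : ∀ {A} → A ∈ᶠ 𝓕 → ∣ A ∣ ≤ ∣ A₀ ∣ → 1 ≤ ∣ A ─ Y ∣
      ⊈Y {A} A∈ A≤A₀ = ℕ.≤-trans ((A∈ , B∈) ⊈ᶠ ≢-by-size (ℕ.≤-<-trans A≤A₀ A₀<B))
        (subst (∣ A ─ B ∣ ≤_) (trans (cong (∣ A ─ Y ∣ ℕ.+_) Y⊆B) (ℕ.+-identityʳ _)) (∣─∣-triangle A Y B))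

      Y─A≤k : ∀ {A} → A ∈ᶠ 𝓕 → ∣ A ∣ ≤ ∣ A₀ ∣ → ∣ Y ─ A ∣ ≤ k
      Y─A≤k A∈ A≤A₀ = ℕ.≤-trans Y─≤ (proj₂ (differencing _ _ B∈ A∈ (≢-by-size (ℕ.≤-<-trans A≤A₀ A₀<B) ∘ sym)))

      Y─X≤k : ∣ Y ─ X ∣ ≤ k
      Y─X≤k = ℕ.≤-trans Y─≤ (A─X≤k B∈ A₀<B)

      ∣X∣≡1+∣Y∣ : ∣ X ∣ ≡ suc ∣ Y ∣
      ∣X∣≡1+∣Y∣ = trans ∣X∣ (cong suc (sym ∣Y∣))

      -- Doubling the sizes leaves the odd key 2 ∣ A₀ ∣ + 1 strictly between the minimum level and
      -- the next.
      κ : Subset n → ℕ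
      κ A = 2 * ∣ A ∣

      mono : ∀ {A D} → A ∈ᶠ 𝓕 → D ∈ᶠ 𝓕 → κ A ≤ κ D → ∣ A ∣ ≤ ∣ D ∣
      mono _ _ = ℕ.*-cancelˡ-≤ 2

      above : ∀ A → suc (2 * ∣ A₀ ∣) ≤ κ A → ∣ A₀ ∣ < ∣ A ∣
      above A = ℕ.*-cancelˡ-< 2 _ _

      below : ∀ A → κ A ≤ suc (2 * ∣ A₀ ∣) → ∣ A ∣ ≤ ∣ A₀ ∣
      below A A≤ = ℕ.≤-pred (ℕ.*-cancelˡ-< 2 ∣ A ∣ (suc ∣ A₀ ∣) (subst (κ A <_) (sym (ℕ.*-suc 2 ∣ A₀ ∣)) (s≤s A≤)))

      ≤Y : ∀ (A : Subset n) → ∣ A ∣ ≤ ∣ A₀ ∣ → ∣ A ∣ ≤ ∣ Y ∣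
      ≤Y A = subst (_ ≤_) (sym ∣Y∣)

      X≤ : ∀ (A : Subset n) → ∣ A₀ ∣ < ∣ A ∣ → ∣ X ∣ ≤ ∣ A ∣
      X≤ A = subst (_≤ _) (sym ∣X∣)

      by-size : Dec (∣ A₀ ∣ < k) → card 𝓕 < n C k
      -- `X` may have exactly `k` elements here; the inclusion functional is used all the same,
      -- since ∣ Y ∣ < k is what the complementary weights need.
      by-size (yes A₀<k) = card<nCk κ mono (suc (2 * ∣ A₀ ∣)) 𝟙[ X ⊆_] (coweightOn (n ∸ k) Y)
        (coweightOn-detects-larger k (n ∸ k) k+[n∸k]≡n X Y Y<k ∣X∣≡1+∣Y∣ (─-small X Y Y<k))
        (λ { {A} (yes A<k) A∈ A> → coweightOn-annihilates k (n ∸ k) k+[n∸k]≡n X A (X≤ A (above A A>)) (ℕ.<⇒≤ A<k) (X⊈ A∈ (above A A>)) (─-small X A A<k)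
           ; {A} (no  A≮k) A∈ A> → ∑-zero xs λ T → 𝟙-chain X T A (X⊈ A∈ (above A A>)) })
        (λ { {A} (yes A<k) A∈ A< → coweightOn-annihilates k (n ∸ k) k+[n∸k]≡n A Y (≤Y A (below A A<)) (ℕ.<⇒≤ Y<k) (⊈Y A∈ (below A A<)) (─-small A Y Y<k)
           ; {A} (no  A≮k) A∈ A< → contradiction (ℕ.≤-<-trans (below A A<) A₀<k) A≮k })
        where
        Y<k : ∣ Y ∣ < k
        Y<k = subst (_< k) (sym ∣Y∣) A₀<k
      by-size (no  A₀≮k) = card<nCk κ mono (suc (2 * ∣ A₀ ∣)) (weightOn k X) 𝟙[_⊆ Y ]
        (weightOn-detects-smaller k X Y (ℕ.<⇒≤ k<X) k<X ∣X∣≡1+∣Y∣ Y─X≤k)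
        (λ { (yes A<k) A∈ A> → contradiction (ℕ.≤-<-trans (minimal A∈) A<k) A₀≮k
           ; {A} (no A≮k) A∈ A> → weightOn-annihilates k X A (ℕ.<⇒≤ k<X) (X≤ A (above A A>)) (X⊈ A∈ (above A A>)) (A─X≤k A∈ (above A A>)) })
        (λ { (yes A<k) A∈ A< → contradiction (ℕ.≤-<-trans (minimal A∈) A<k) A₀≮k
           ; {A} (no A≮k) A∈ A< → weightOn-annihilates k A Y (ℕ.≮⇒≥ A≮k) (≤Y A (below A A<)) (⊈Y A∈ (below A A<)) (Y─A≤k A∈ (below A A<)) })
        where
        k<X : k < ∣ X ∣
        k<X = subst (k <_) (sym ∣X∣) (s≤s (ℕ.≮⇒≥ A₀≮k))

    -- Evaluation at `T` kills the vectors of the members not containing `T`, and the functionals of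
    -- the members containing `T` kill the probe. The probe takes the value p(q - k) at `T`, nonzero
    -- as k < l and l ≠ n - k.
    uniform⇒card<nCk : ∀ {l} → (∀ {A} → A ∈ᶠ 𝓕 → ∣ A ∣ ≡ l) → l ≤ n → k < l → l ≢ n ∸ k → card 𝓕 < n C k
    uniform⇒card<nCk {l} uniform l≤n k<l l≢n∸k with subset {n} ⊤ k (subst (k ≤_) (sym (∣⊤∣≡n n)) k≤n)
    ... | T , _ , ∣T∣ = card<nCk (λ A → level ∣ T ─ A ∣)
        (λ A∈ B∈ _ → ℕ.≤-reflexive (trans (uniform A∈) (sym (uniform B∈)))) 1
        𝟙[ T ⊆_] (probe k p q T)
        (subst (_≢ 0ℤ) (sym (trans (∑-point T k ∣T∣ (probe k p q T)) (probe-at k p q T sizes ∣T∣))) (*-≢0 p≢0 q-k≢0))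
        (λ { (yes A<k) A∈ _ → contradiction A<k (large A∈)
           ; {A} (no _) A∈ A> → ∑-zero xs λ T′ → 𝟙-chain T T′ A (positive _ A>) })
        (λ { (yes A<k) A∈ _ → contradiction A<k (large A∈)
           ; {A} (no _) A∈ A< → weightOn-annihilates-probe k p q A T 1≤k (trans (uniform A∈) (sym p+k≡l)) sizes ∣T∣ (null _ A<) })
      where
      -- Members containing `T` get key 0 and the others key 2, on either side of the new test at
      -- key 1. All sizes are equal, so this key is admissible.
      level : ℕ → ℕ
      level zero    = 0
      level (suc _) = 2
      positive : ∀ d → 1 ≤ level d → 1 ≤ d
      positive (suc d) _ = s≤s z≤n
      null : ∀ d → level d ≤ 1 → d ≡ 0
      null zero    _        = refl
      null (suc d) (s≤s ())
      p q : ℕ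
      p = l ∸ k
      q = n ∸ l
      p+k≡l : p ℕ.+ k ≡ l
      p+k≡l = ℕ.m∸n+n≡m (ℕ.<⇒≤ k<l)
      sizes : p ℕ.+ k ℕ.+ q ≡ n
      sizes = trans (cong (ℕ._+ q) p+k≡l) (ℕ.m+[n∸m]≡n l≤n)
      p≢0 : + p ≢ 0ℤ
      p≢0 eq = ℕ.<⇒≢ (ℕ.m<n⇒0<n∸m k<l) (sym (ℤ.+-injective eq))
      q-k≢0 : + q ℤ.- + k ≢ 0ℤ
      q-k≢0 eq = l≢n∸k (trans (sym (ℕ.m∸[m∸n]≡n l≤n)) (cong (n ∸_) (ℤ.+-injective (ℤ.i-j≡0⇒i≡j (+ q) (+ k) eq))))
      large : ∀ {A} → A ∈ᶠ 𝓕 → ∣ A ∣ ℕ.≮ k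
      large A∈ A<k = ℕ.<-asym k<l (subst (_< k) (uniform A∈) A<k)

-- Layers and binomial coefficients

⊆⇒length≤ : ∀ {a} {I : Set a} {xs ys : List I} → Unique xs → (∀ {x} → x ∈ xs → x ∈ ys) → length xs ≤ length ys
⊆⇒length≤ {xs = []}     _          _ = z≤n
⊆⇒length≤ {xs = x ∷ xs} (x∉ ∷ uni) sub with ∈-∃++ (sub (here refl))
... | as , bs , refl = subst (suc (length xs) ≤_) (sym eq) (s≤s (⊆⇒length≤ uni sub′))
  where
  eq : length (as ++ x ∷ bs) ≡ suc (length (as ++ bs))
  eq = trans (length-++ as) (trans (ℕ.+-suc (length as) _) (cong suc (sym (length-++ as))))
  sub′ : ∀ {y} → y ∈ xs → y ∈ as ++ bs
  sub′ y∈ with ∈-++⁻ as (sub (there y∈))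
  ... | inj₁ y∈as           = ∈-++⁺ˡ y∈as
  ... | inj₂ (here refl)    = contradiction refl (All.lookup x∉ y∈)
  ... | inj₂ (there y∈bs)   = ∈-++⁺ʳ as y∈bs

∈-kSubsets⁺ : ∀ {n} k (A : Subset n) → ∣ A ∣ ≡ k → A ∈ kSubsets n k
∈-kSubsets⁺ zero    []            _  = here refl
∈-kSubsets⁺ zero    (outside ∷ A) eq = ∈-map⁺ _ (∈-kSubsets⁺ zero A eq)
∈-kSubsets⁺ (suc k) (outside ∷ A) eq = ∈-++⁺ˡ (∈-map⁺ _ (∈-kSubsets⁺ (suc k) A eq))
∈-kSubsets⁺ (suc k) (inside  ∷ A) eq = ∈-++⁺ʳ _ (∈-map⁺ _ (∈-kSubsets⁺ k A (ℕ.suc-injective eq)))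

∈-kSubsets⁻ : ∀ n k {A : Subset n} → A ∈ kSubsets n k → ∣ A ∣ ≡ k
∈-kSubsets⁻ zero    zero    (here refl) = refl
∈-kSubsets⁻ (suc n) zero    A∈ with ∈-map⁻ _ A∈
... | B , B∈ , refl = ∈-kSubsets⁻ n zero B∈
∈-kSubsets⁻ (suc n) (suc k) A∈ with ∈-++⁻ (map (outside ∷_) (kSubsets n (suc k))) A∈
... | inj₁ A∈ˡ with ∈-map⁻ _ A∈ˡ
...   | B , B∈ , refl = ∈-kSubsets⁻ n (suc k) B∈
∈-kSubsets⁻ (suc n) (suc k) A∈ | inj₂ A∈ʳ with ∈-map⁻ _ A∈ʳ
...   | B , B∈ , refl = cong suc (∈-kSubsets⁻ n k B∈)

kSubsets-unique : ∀ n k → Unique (kSubsets n k)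
kSubsets-unique zero    zero    = [] ∷ []
kSubsets-unique zero    (suc k) = []
kSubsets-unique (suc n) zero    = Unique.map⁺ ∷-injectiveʳ (kSubsets-unique n zero)
kSubsets-unique (suc n) (suc k) =
  Unique.++⁺ (Unique.map⁺ ∷-injectiveʳ (kSubsets-unique n (suc k))) (Unique.map⁺ ∷-injectiveʳ (kSubsets-unique n k))
    λ (A∈ˡ , A∈ʳ) → disjoint (∈-map⁻ _ A∈ˡ) (∈-map⁻ _ A∈ʳ)
  where
  disjoint : ∀ {A : Subset (suc n)} {P Q : Subset n → Set} →
    ∃[ B ] P B × A ≡ outside ∷ B → ¬ (∃[ B ] Q B × A ≡ inside ∷ B)
  disjoint (_ , _ , refl) (_ , _ , ())

uniform⇒card≤nCl : ∀ {n} (𝓕 : Family n) l → (∀ {A} → A ∈ᶠ 𝓕 → ∣ A ∣ ≡ l) → card 𝓕 ≤ n C l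
uniform⇒card≤nCl {n} 𝓕 l uniform = subst (card 𝓕 ≤_) (length-kSubsets n l)
  (⊆⇒length≤ (unique 𝓕) λ {A} A∈ → ∈-kSubsets⁺ l A (uniform A∈))

≗Layer⇒card≡nCl : ∀ {n} (𝓕 : Family n) l → 𝓕 ≗ Layer n l → card 𝓕 ≡ n C l
≗Layer⇒card≡nCl {n} 𝓕 l (uniform , full) = ℕ.≤-antisym (uniform⇒card≤nCl 𝓕 l uniform)
  (subst (_≤ card 𝓕) (length-kSubsets n l) (⊆⇒length≤ (kSubsets-unique n l) λ A∈ → full (∈-kSubsets⁻ n l A∈)))

card≡nCl⇒≗Layer : ∀ {n} (𝓕 : Family n) l → (∀ {A} → A ∈ᶠ 𝓕 → ∣ A ∣ ≡ l) → card 𝓕 ≡ n C l → 𝓕 ≗ Layer n l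
card≡nCl⇒≗Layer {n} 𝓕 l uniform eq = uniform , full
  where
  full : ∀ {A} → ∣ A ∣ ≡ l → A ∈ᶠ 𝓕
  full {A} ∣A∣ with ∈-dec (≡-dec _≟ᵇ_) A (members 𝓕)
  ... | yes A∈ = A∈
  ... | no  A∉ = contradiction (uniform⇒card≤nCl 𝓕⁺ l uniform⁺) (ℕ.<⇒≱ (s≤s (ℕ.≤-reflexive (sym eq))))
    where
    𝓕⁺ : Family n
    𝓕⁺ = family (A ∷ members 𝓕) (All.tabulate (λ { B∈ refl → A∉ B∈ }) ∷ unique 𝓕)
    uniform⁺ : ∀ {B} → B ∈ᶠ 𝓕⁺ → ∣ B ∣ ≡ l
    uniform⁺ (here refl) = ∣A∣
    uniform⁺ (there B∈)  = uniform B∈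

-- Growth of binomial coefficients up to the middle.

C-ratio : ∀ q r → ((q ℕ.+ r) C suc q) * suc q ≡ ((q ℕ.+ r) C q) * r
C-ratio q r = ℤ.+-injective (begin
  + (((q ℕ.+ r) C suc q) * suc q)              ≡⟨ ℤ.pos-* ((q ℕ.+ r) C suc q) (suc q) ⟩
  + ((q ℕ.+ r) C suc q) ℤ.* + suc q            ≡⟨ C-absorb (q ℕ.+ r) q ⟩
  + ((q ℕ.+ r) C q) ℤ.* (+ q ℤ.+ + r ℤ.- + q)  ≡⟨ cong (ℤ._*_ (+ ((q ℕ.+ r) C q))) (cancel (+ q) (+ r)) ⟩
  + ((q ℕ.+ r) C q) ℤ.* + r                    ≡⟨ ℤ.pos-* ((q ℕ.+ r) C q) r ⟨
  + (((q ℕ.+ r) C q) * r)                      ∎)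
  where
  open ≡-Reasoning
  cancel : ∀ q r → q ℤ.+ r ℤ.- q ≡ r
  cancel = solve-∀

-- With r = n - q the ratio of the two coefficients is r / (q + 1), and the hypothesis says q + 1 ≤
-- r.
C-step-≤ : ∀ n q → q ℕ.+ suc q ≤ n → n C q ≤ n C suc q
C-step-≤ n q h with ℕ.m≤n⇒∃[o]m+o≡n (ℕ.m+n≤o⇒m≤o q h)
... | r , refl = ℕ.*-cancelʳ-≤ _ _ (suc q) (ℕ.≤-trans
  (ℕ.*-monoʳ-≤ ((q ℕ.+ r) C q) (ℕ.+-cancelˡ-≤ q _ _ h)) (ℕ.≤-reflexive (sym (C-ratio q r))))

C-step-< : ∀ n q → q ℕ.+ suc q < n → n C q < n C suc q
C-step-< n q h with ℕ.m≤n⇒∃[o]m+o≡n (ℕ.m+n≤o⇒m≤o q (ℕ.<⇒≤ h))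
... | r , refl = ℕ.*-cancelʳ-< (suc q) _ _ (ℕ.<-≤-trans
  (ℕ.*-monoʳ-< ((q ℕ.+ r) C q) ⦃ ℕ.>-nonZero (1≤C (ℕ.m≤m+n q r)) ⦄ (ℕ.+-cancelˡ-< q _ _ h)) (ℕ.≤-reflexive (sym (C-ratio q r))))

-- The last step, from l + d - 1 to l + d, needs 2(l + d) - 1 ≤ n, which is the hypothesis.
C-mono-≤ : ∀ n l d → l ℕ.+ d ℕ.+ (l ℕ.+ d) ≤ suc n → n C l ≤ n C (l ℕ.+ d)
C-mono-≤ n l zero    h = ℕ.≤-reflexive (cong (n C_) (sym (ℕ.+-identityʳ l)))
C-mono-≤ n l (suc d) h rewrite ℕ.+-suc l d = ℕ.≤-trans
  (C-mono-≤ n l d (ℕ.≤-trans (ℕ.+-mono-≤ (ℕ.n≤1+n (l ℕ.+ d)) (ℕ.n≤1+n (l ℕ.+ d))) h))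
  (C-step-≤ n (l ℕ.+ d) (ℕ.≤-pred h))

-- Strictness is taken from the first step, where l + (l + 1) ≤ l + k < n; a later step can be an
-- equality, as the one from k - 1 to k is when n = 2k - 1.
C-mono-< : ∀ n l k → l < k → k ℕ.+ k ≤ suc n → l ℕ.+ k < n → n C l < n C k
C-mono-< n l k l<k h l+k<n with ℕ.m≤n⇒∃[o]m+o≡n l<k
... | d , refl = ℕ.<-≤-trans
  (C-step-< n l (ℕ.≤-<-trans (ℕ.+-monoʳ-≤ l (ℕ.m≤m+n (suc l) d)) l+k<n)) (C-mono-≤ n (suc l) d h)

-- The bound and the equality case.

smallest : ∀ {n} (A : Subset n) As → ∃[ M ] M ∈ A ∷ As × (∀ {B} → B ∈ A ∷ As → ∣ M ∣ ≤ ∣ B ∣)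
smallest A []       = A , here refl , λ { (here refl) → ℕ.≤-refl }
smallest A (D ∷ As) with smallest D As
... | M , M∈ , min with ℕ.≤-total ∣ A ∣ ∣ M ∣
...   | inj₁ A≤M = A , here refl , λ { (here refl) → ℕ.≤-refl ; (there B∈) → ℕ.≤-trans A≤M (min B∈) }
...   | inj₂ M≤A = M , there M∈ , λ { (here refl) → M≤A ; (there B∈) → min B∈ }

theorem1p3 : ∀ (k n : ℕ) → 1 ≤ k → 2 * k ∸ 1 ≤ n →
    (𝓕 : Family n) → Differencing k 𝓕 →
    (card 𝓕 ≤ n C k) ×
    ((card 𝓕 ≡ n C k) ⇔ ((𝓕 ≗ Layer n k) ⊎ (𝓕 ≗ Layer n (n ∸ k))))
theorem1p3 k n 1≤k h 𝓕 differencing = card≤nCk k h 1≤k 𝓕 differencing , mk⇔ extremal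
  [ ≗Layer⇒card≡nCl 𝓕 k , (λ eq → trans (≗Layer⇒card≡nCl 𝓕 (n ∸ k) eq) (sym symmetric)) ]′
  where
  symmetric : n C k ≡ n C (n ∸ k)
  symmetric = nCk≡nC[n∸k] (k≤n k h 1≤k)

  k+k≤1+n : k ℕ.+ k ≤ suc n
  k+k≤1+n = ℕ.≤-trans (ℕ.m≤n+m∸n (k ℕ.+ k) 1)
    (s≤s (subst (λ j → k ℕ.+ j ∸ 1 ≤ n) (ℕ.+-identityʳ k) h))

  uniform-extremal : ∀ l → l ≤ n → (∀ {A} → A ∈ᶠ 𝓕 → ∣ A ∣ ≡ l) → card 𝓕 ≡ n C k →
    (𝓕 ≗ Layer n k) ⊎ (𝓕 ≗ Layer n (n ∸ k))
  uniform-extremal l l≤n uniform eq with l ℕ.≟ k | l ℕ.≟ n ∸ k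
  ... | yes refl | _        = inj₁ (card≡nCl⇒≗Layer 𝓕 l uniform eq)
  ... | no  _    | yes refl = inj₂ (card≡nCl⇒≗Layer 𝓕 l uniform (trans eq symmetric))
  ... | no  l≢k  | no l≢n∸k with ℕ.<-cmp l k
  ...   | tri≈ _ l≡k _ = contradiction l≡k l≢k
  ...   | tri> _ _ k<l = contradiction eq (ℕ.<⇒≢ (uniform⇒card<nCk k h 1≤k 𝓕 differencing uniform l≤n k<l l≢n∸k))
  ...   | tri< l<k _ _ = contradiction eq (ℕ.<⇒≢ (ℕ.≤-<-trans (uniform⇒card≤nCl 𝓕 l uniform) (C-mono-< n l k l<k k+k≤1+n l+k<n)))
    where
    l+k<n : l ℕ.+ k < n
    l+k<n = subst (l ℕ.+ k <_) (ℕ.m∸n+n≡m (k≤n k h 1≤k)) (ℕ.+-monoˡ-< k (ℕ.≤∧≢⇒< (<k⇒≤n∸k k h 1≤k l<k) l≢n∸k))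

  extremal : card 𝓕 ≡ n C k → (𝓕 ≗ Layer n k) ⊎ (𝓕 ≗ Layer n (n ∸ k))
  extremal eq = from-smallest (members 𝓕) refl
    where
    from-smallest : ∀ As → members 𝓕 ≡ As → (𝓕 ≗ Layer n k) ⊎ (𝓕 ≗ Layer n (n ∸ k))
    from-smallest []       ≡As = contradiction (trans (sym (cong length ≡As)) eq) (ℕ.<⇒≢ (1≤C (k≤n k h 1≤k)))
    from-smallest (A ∷ As) ≡As with smallest A As
    ... | M , M∈ , min = uniform-extremal ∣ M ∣ (∣p∣≤n M) uniform eq
      where
      min𝓕 : ∀ {B} → B ∈ᶠ 𝓕 → ∣ M ∣ ≤ ∣ B ∣
      min𝓕 B∈ = min (subst (_ ∈_) ≡As B∈)
      -- A member larger than the minimum `M` would make the bound strict, so equality forces a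
      -- single level.
      uniform : ∀ {B} → B ∈ᶠ 𝓕 → ∣ B ∣ ≡ ∣ M ∣
      uniform {B} B∈ with ∣ M ∣ ℕ.<? ∣ B ∣
      ... | yes M<B = contradiction eq
              (ℕ.<⇒≢ (nonuniform⇒card<nCk k h 1≤k 𝓕 differencing (subst (M ∈_) (sym ≡As) M∈) B∈ min𝓕 M<B))
      ... | no  M≮B = ℕ.≤-antisym (ℕ.≮⇒≥ M≮B) (min𝓕 B∈)
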